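{- Let $G$ be a connected, well-edge-dominated graph containing exactly one triangle $xyz$ such that the subgraph induced by $V(G)-\{x,y,z\}$ contains a nontrivial component no vertex of which is adjacent to $x$ or to $y$. Then $G\in\mathcal{F}\cup\mathcal{T}$.
   Context: All graphs are simple and finite. A set $F$ of edges of $G$ is an edge dominating set if every edge of $G$ is in $F$ or shares an endpoint with an edge of $F$. $G$ is well-edge-dominated if all minimal (with respect to inclusion) edge dominating sets of $G$ have the same cardinality. A triangle is a subgraph isomorphic to $K_3$. A graph is nontrivial if it has at least two vertices. A support vertex is a vertex adjacent to a vertex of degree $1$. Let $G'$ be a well-edge-dominated bipartite graph with bipartition $V(G')=A\cup B$, $|A|<|B|$. A vertex $w\in B$ is detachable if $G'-w$ is well-edge-dominated; it is strongly detachable if it is detachable and every vertex of $N_{G'}(w)$ is a support vertex in $G'-w$. The house graph $\mathcal{H}$ has vertices $p_1,\dots,p_5$ and edges $p_1p_2,p_2p_3,p_3p_4,p_4p_1,p_3p_5,p_4p_5$. $\mathcal{T}$ is the family of graphs obtained from the disjoint union of $K_3$ and a well-edge-dominated bipartite graph $G'$ with bipartition $A\cup B$, $|A|<|B|$, by identifying a vertex of $K_3$ with a detachable vertex $w\in B$ of $G'$. $\mathcal{F}$ is the family of graphs obtained from the disjoint union of $\mathcal{H}$ and such a graph $G'$ by identifying the vertex $p_5$ of $\mathcal{H}$ with a strongly detachable vertex $w\in B$ of $G'$. -}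

module Defs where

open import Data.Nat using (ℕ; zero; suc; _+_)
import Data.Nat as Nat
open import Data.Bool using (Bool; true; false; _∧_; not; if_then_else_)
open import Data.Fin using (Fin; zero; suc; punchIn; splitAt; _≟_)
import Data.Fin as Fin
open import Data.Fin.Properties using (punchInᵢ≢i)
open import Data.Sum using (_⊎_; inj₁; inj₂)
open import Data.Product using (Σ; ∃; _×_; _,_)
open import Data.Unit using (⊤)
open import Data.List using (List; length)
open import Data.List.Relation.Unary.All using (All)
open import Data.List.Relation.Unary.Any using (Any)
open import Data.List.Relation.Unary.Unique.Propositional using (Unique)
open import Data.List.Relation.Binary.Subset.Propositional using (_⊆_)
open import Relation.Nullary using (¬_)
open import Relation.Nullary.Decidable using (⌊_⌋)
open import Relation.Binary.PropositionalEquality using (_≡_; _≢_; refl)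
open import Function.Bundles using (_↔_; Inverse)

record Graph (n : ℕ) : Set where
  field
    adj    : Fin n → Fin n → Bool
    sym    : ∀ u v → adj u v ≡ adj v u
    irrefl : ∀ u → adj u u ≡ false
open Graph public

Edge : ∀ {n} → Graph n → Fin n → Fin n → Set
Edge G u v = adj G u v ≡ true

card : ∀ {m} → (Fin m → Bool) → ℕ
card {zero}  f = 0
card {suc m} f = (if f zero then 1 else 0) + card (λ i → f (suc i))

degree : ∀ {n} → Graph n → Fin n → ℕ
degree G v = card (adj G v)

data ReachIn {n} (G : Graph n) (P : Fin n → Set) : Fin n → Fin n → Set where
  here : ∀ {u} → P u → ReachIn G P u u
  step : ∀ {u w v} → P u → Edge G u w → ReachIn G P w v → ReachIn G P u v

Connected : ∀ {n} → Graph n → Set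
Connected {n} G = ∀ (u v : Fin n) → ReachIn G (λ _ → ⊤) u v

EdgeSet : ℕ → Set
EdgeSet n = List (Fin n × Fin n)

ValidEdgeSet : ∀ {n} → Graph n → EdgeSet n → Set
ValidEdgeSet G F = All (λ { (u , v) → Edge G u v × u Fin.< v }) F × Unique F

SharesEndpoint : ∀ {n} → Fin n → Fin n → Fin n × Fin n → Set
SharesEndpoint u v (a , b) = a ≡ u ⊎ a ≡ v ⊎ b ≡ u ⊎ b ≡ v

IsEDS : ∀ {n} → Graph n → EdgeSet n → Set
IsEDS G F = ValidEdgeSet G F
          × (∀ u v → Edge G u v → Any (SharesEndpoint u v) F)

IsMinimalEDS : ∀ {n} → Graph n → EdgeSet n → Set
IsMinimalEDS G F = IsEDS G F × (∀ F' → IsEDS G F' → F' ⊆ F → F ⊆ F')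

WellEdgeDominated : ∀ {n} → Graph n → Set
WellEdgeDominated G = ∀ F F' → IsMinimalEDS G F → IsMinimalEDS G F'
                      → length F ≡ length F'

Triangle : ∀ {n} → Graph n → Fin n → Fin n → Fin n → Set
Triangle G x y z = Edge G x y × Edge G y z × Edge G x z

In3 : ∀ {n} → Fin n → Fin n → Fin n → Fin n → Set
In3 x y z a = a ≡ x ⊎ a ≡ y ⊎ a ≡ z

-- xyz is the only triangle of G (vertices of a triangle are distinct
-- by irreflexivity, so this says {a,b,c} = {x,y,z} as sets)
UniqueTriangle : ∀ {n} → Graph n → Fin n → Fin n → Fin n → Set
UniqueTriangle G x y z = Triangle G x y z
  × (∀ a b c → Triangle G a b c → In3 x y z a × In3 x y z b × In3 x y z c)

deleteV : ∀ {m} → Graph (suc m) → Fin (suc m) → Graph m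
deleteV G w = record
  { adj = λ i j → adj G (punchIn w i) (punchIn w j)
  ; sym = λ i j → sym G (punchIn w i) (punchIn w j)
  ; irrefl = λ i → irrefl G (punchIn w i) }

Support : ∀ {n} → Graph n → Fin n → Set
Support G s = ∃ λ l → Edge G s l × degree G l ≡ 1

-- Bipartite well-edge-dominated graphs with bipartition A ∪ B, |A| < |B|.
-- side i ≡ true means i ∈ B, side i ≡ false means i ∈ A.

IsBipartition : ∀ {m} → Graph m → (Fin m → Bool) → Set
IsBipartition G side = ∀ u v → Edge G u v → side u ≢ side v

DetachableSetup : ∀ {m} → Graph (suc m) → (Fin (suc m) → Bool) → Fin (suc m) → Set
DetachableSetup G' side w =
    IsBipartition G' side
  × card (λ i → not (side i)) Nat.< card side
  × WellEdgeDominated G'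
  × side w ≡ true
  × WellEdgeDominated (deleteV G' w)

StronglyDetachableSetup : ∀ {m} → Graph (suc m) → (Fin (suc m) → Bool) → Fin (suc m) → Set
StronglyDetachableSetup G' side w =
    DetachableSetup G' side w
  × (∀ i → Edge G' w (punchIn w i) → Support (deleteV G' w) i)

module _ {k m : ℕ} (H : Graph k) (link : Fin k → Bool) (G' : Graph m) (w : Fin m) where
  sumAdj : Fin k ⊎ Fin m → Fin k ⊎ Fin m → Bool
  sumAdj (inj₁ a) (inj₁ b) = adj H a b
  sumAdj (inj₁ a) (inj₂ j) = link a ∧ ⌊ j ≟ w ⌋
  sumAdj (inj₂ i) (inj₁ b) = link b ∧ ⌊ i ≟ w ⌋
  sumAdj (inj₂ i) (inj₂ j) = adj G' i j

  sumAdj-sym : ∀ s t → sumAdj s t ≡ sumAdj t s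
  sumAdj-sym (inj₁ a) (inj₁ b) = sym H a b
  sumAdj-sym (inj₁ a) (inj₂ j) = refl
  sumAdj-sym (inj₂ i) (inj₁ b) = refl
  sumAdj-sym (inj₂ i) (inj₂ j) = sym G' i j

  sumAdj-irr : ∀ s → sumAdj s s ≡ false
  sumAdj-irr (inj₁ a) = irrefl H a
  sumAdj-irr (inj₂ i) = irrefl G' i

  glue : Graph (k + m)
  glue = record
    { adj = λ u v → sumAdj (splitAt k u) (splitAt k v)
    ; sym = λ u v → sumAdj-sym (splitAt k u) (splitAt k v)
    ; irrefl = λ u → sumAdj-irr (splitAt k u) }

-- K2 on {0,1}; joining both vertices to w gives a K3 one of whose vertices is w.
K2 : Graph 2
K2 = record { adj = a ; sym = s ; irrefl = i }
  where
  a : Fin 2 → Fin 2 → Bool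
  a zero zero = false
  a zero (suc zero) = true
  a (suc zero) zero = true
  a (suc zero) (suc zero) = false
  s : ∀ u v → a u v ≡ a v u
  s zero zero = refl
  s zero (suc zero) = refl
  s (suc zero) zero = refl
  s (suc zero) (suc zero) = refl
  i : ∀ u → a u u ≡ false
  i zero = refl
  i (suc zero) = refl

-- The 4-cycle p1 p2 p3 p4 (vertices 0,1,2,3); joining p3, p4 to w = p5
-- gives the house graph with p5 identified with w.
C4 : Graph 4
C4 = record { adj = a ; sym = s ; irrefl = i }
  where
  a : Fin 4 → Fin 4 → Bool
  a zero (suc zero) = true
  a (suc zero) zero = true
  a (suc zero) (suc (suc zero)) = true
  a (suc (suc zero)) (suc zero) = true
  a (suc (suc zero)) (suc (suc (suc zero))) = true
  a (suc (suc (suc zero))) (suc (suc zero)) = true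
  a (suc (suc (suc zero))) zero = true
  a zero (suc (suc (suc zero))) = true
  a _ _ = false
  s : ∀ u v → a u v ≡ a v u
  s zero zero = refl
  s zero (suc zero) = refl
  s zero (suc (suc zero)) = refl
  s zero (suc (suc (suc zero))) = refl
  s (suc zero) zero = refl
  s (suc zero) (suc zero) = refl
  s (suc zero) (suc (suc zero)) = refl
  s (suc zero) (suc (suc (suc zero))) = refl
  s (suc (suc zero)) zero = refl
  s (suc (suc zero)) (suc zero) = refl
  s (suc (suc zero)) (suc (suc zero)) = refl
  s (suc (suc zero)) (suc (suc (suc zero))) = refl
  s (suc (suc (suc zero))) zero = refl
  s (suc (suc (suc zero))) (suc zero) = refl
  s (suc (suc (suc zero))) (suc (suc zero)) = refl
  s (suc (suc (suc zero))) (suc (suc (suc zero))) = refl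
  i : ∀ u → a u u ≡ false
  i zero = refl
  i (suc zero) = refl
  i (suc (suc zero)) = refl
  i (suc (suc (suc zero))) = refl

houseLink : Fin 4 → Bool
houseLink (suc (suc zero)) = true
houseLink (suc (suc (suc zero))) = true
houseLink _ = false

_≅_ : ∀ {n n'} → Graph n → Graph n' → Set
_≅_ {n} {n'} G H = Σ (Fin n ↔ Fin n') λ f →
  ∀ u v → adj H (Inverse.to f u) (Inverse.to f v) ≡ adj G u v

In𝒯 : ∀ {n} → Graph n → Set
In𝒯 G = Σ ℕ λ m → Σ (Graph (suc m)) λ G' → Σ (Fin (suc m) → Bool) λ side →
  Σ (Fin (suc m)) λ w → DetachableSetup G' side w
    × (G ≅ glue K2 (λ _ → true) G' w)

Inℱ : ∀ {n} → Graph n → Set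
Inℱ G = Σ ℕ λ m → Σ (Graph (suc m)) λ G' → Σ (Fin (suc m) → Bool) λ side →
  Σ (Fin (suc m)) λ w → StronglyDetachableSetup G' side w
    × (G ≅ glue C4 houseLink G' w)

-- V(G) - {x,y,z} has a nontrivial component no vertex of which is
-- adjacent to x or y: the component of u (in the induced subgraph on
-- V(G) - {x,y,z}) contains a vertex v ≠ u, and no vertex of it is
-- adjacent to x or y.

HasFarComponent : ∀ {n} → Graph n → Fin n → Fin n → Fin n → Set
HasFarComponent G x y z = ∃ λ u → ∃ λ v →
    Outside u × u ≢ v × ReachIn G Outside u v
  × (∀ t → ReachIn G Outside u t → adj G t x ≡ false × adj G t y ≡ false)
  where
  Outside = λ a → ¬ In3 x y z a

{-# OPTIONS --safe #-}

-- Maximal matchings are minimal edge dominating sets, and deleting the endpoints of a matching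
-- preserves well-edge-dominatedness.  Let S be the component of G − z containing x and y, and
-- let D be the rest of G − z.  Comparing maximal matchings of G that use different edges at z
-- shows that every maximal matching of S, or of D, saturates all neighbours of z in it.  For S
-- this forces S = {x, y} or a 4-cycle x y q p: otherwise S contains a K₃,₃ through x y, and an
-- edge dominating set that is not a matching has the wrong size.  On W = D ∪ {z} all maximal
-- matchings have the same size as those of D.  Call a vertex missable if some maximal matching of
-- W misses it.  By induction along paths z, c, d, … (the pair (D − c, d) inherits the hypotheses on
-- (W, z)), every edge of W has exactly one missable end, so the missable vertices form the side B.
module Submission where

open import Defs
open import Data.Bool using (Bool; true; false; not; _∧_; if_then_else_)
import Data.Bool as Bool
open import Data.Bool.Properties using (∧-identityʳ; ∧-zeroʳ; ¬-not)
open import Data.Empty using (⊥; ⊥-elim)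
open import Data.Fin using (Fin; zero; suc; _≟_; splitAt; join; punchIn; punchOut)
import Data.Fin as Fin
open import Data.Fin.Properties
  using (any?; all?; ¬∀⟶∃¬; punchIn-punchOut; punchIn-injective; punchInᵢ≢i; <-cmp
        ; splitAt-join; join-splitAt; suc-injective)
open import Data.List
  using (List; []; _∷_; filter; lookup; length; tabulate; allFin; cartesianProduct)
open import Data.List.Membership.Propositional using (_∈_; find; lose)
open import Data.List.Membership.Propositional.Properties
  using (∈-allFin; ∈-cartesianProduct⁺; ∈-filter⁺; ∈-filter⁻; ∈-lookup; ∈-tabulate⁻)
open import Data.List.Properties using (length-tabulate)
open import Data.List.Relation.Unary.All as All using ()
import Data.List.Relation.Unary.All.Properties as Allₚ
open import Data.List.Relation.Unary.AllPairs using (_∷_)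
open import Data.List.Relation.Unary.Any using (Any; here; there; index)
import Data.List.Relation.Unary.Any.Properties as Anyₚ
open import Data.List.Relation.Unary.Unique.Propositional using (Unique)
import Data.List.Relation.Unary.Unique.Propositional.Properties as Uniqueₚ
open import Data.Nat using (ℕ; zero; suc; _+_; _≤_; _<_; z≤n; s≤s; s≤s⁻¹)
import Data.Nat.Properties as ℕₚ
open import Data.Nat.Properties
  using (+-identityʳ; +-suc; +-comm; +-assoc; +-cancelˡ-≡; +-cancelˡ-≤; m≤m+n; 1+n≰n; 1+n≢n
        ; ≤-refl; ≤-trans; ≤-reflexive; ≤-antisym)
open import Data.Product using (Σ; ∃; _×_; _,_; proj₁; proj₂)
open import Data.Product.Properties using (≡-dec)
open import Data.Sum using (_⊎_; inj₁; inj₂; [_,_]′)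
open import Data.Unit using (⊤; tt)
open import Function using (_∘_; id; case_of_; mk↔ₛ′)
open import Relation.Binary.Definitions using (tri<; tri≈; tri>)
open import Relation.Binary.PropositionalEquality
  using (_≡_; _≢_; refl; trans; cong; cong₂; subst; ≢-sym) renaming (sym to ≡-sym)
open import Relation.Nullary using (¬_; Dec; yes; no; does; contradiction)
open import Relation.Nullary.Decidable
  using (_×-dec_; _⊎-dec_; _→-dec_; ¬?; map′; dec-true; dec-false)
open import Relation.Unary using (Decidable; _∪_; _∖_; ∁; ∅)

-- Matchings and edge dominating sets

-- Equal sizes in G say nothing directly about an induced piece. They pass to a piece only when the
-- ends of a chosen matching cut it off from the rest: an edge at z does this for S and for D, and
-- once the neighbours of z in S are known to be saturated, a maximal matching of S does it for W.
-- This is why saturation has to be settled before either side is analysed.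
--
-- Matchings alone cannot finish the proof. All maximal matchings of K₃,₃ are perfect, so with K₃,₃
-- as S the counts at z balance. What excludes it is a star at one of its vertices, each edge of
-- which dominates an edge at a vertex that the star leaves uncovered. In the same way the leaves
-- demanded by strong detachability come from replacing two matching edges of the 4-cycle and
-- nothing at z by three edges at x, one of them leading to z.

module EdgeDomination {n : ℕ} (G : Graph n) where

  V : Set
  V = Fin n

  VSet : Set₁
  VSet = V → Set

  infix 4 _~_
  infixl 7 _-_

  _~_ : V → V → Set
  u ~ v = Edge G u v

  _~?_ : ∀ u v → Dec (u ~ v)
  u ~? v = adj G u v Bool.≟ true

  ~-sym : ∀ {u v} → u ~ v → v ~ u
  ~-sym {u} {v} uv = trans (Graph.sym G v u) uv

  ~⇒≢ : ∀ {u v} → u ~ v → u ≢ v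
  ~⇒≢ {u} uv refl with trans (≡-sym uv) (irrefl G u)
  ... | ()

  _-_ : VSet → V → VSet
  (W - a) v = W v × v ≢ a

  -‿dec : ∀ {W : VSet} → Decidable W → ∀ a → Decidable (W - a)
  -‿dec W? a v = W? v ×-dec ¬? (v ≟ a)

  ∖-dec : ∀ {W X : VSet} → Decidable W → Decidable X → Decidable (W ∖ X)
  ∖-dec W? X? v = W? v ×-dec ¬? (X? v)

  _⊑_ : VSet → VSet → Set
  X ⊑ Y = ∀ {v} → X v → Y v

  -- Matchings are recorded by their set of saturated vertices.
  data Matching (X : VSet) : ℕ → Set where
    empty : (∀ {v} → ¬ X v) → Matching X 0
    add   : ∀ {a b k} → a ~ b → X a → X b → Matching (X - a - b) k → Matching X (suc k)

  abstract
    -- `X` is an arbitrary predicate, but the derivation lists its vertices. Hence the part of a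
    -- decidable set left free by a matching is decidable again, and can be matched further.
    matched? : ∀ {X k} → Matching X k → Decidable X
    matched? (empty e) v = no e
    matched? (add {a} {b} _ xa xb m) v with v ≟ a | v ≟ b
    ... | yes refl | _ = yes xa
    ... | no _ | yes refl = yes xb
    ... | no v≢a | no v≢b =
      map′ (proj₁ ∘ proj₁) (λ xv → (xv , v≢a) , v≢b) (matched? m v)

    resp : ∀ {X Y : VSet} {k} → X ⊑ Y → Y ⊑ X → Matching X k → Matching Y k
    resp f g (empty e) = empty (e ∘ g)
    resp f g (add e xa xb m) =
      add e (f xa) (f xb)
        (resp (λ ((x , p) , q) → (f x , p) , q) (λ ((y , p) , q) → (g y , p) , q) m)

  Adjoin : VSet → V → V → VSet
  Adjoin X a b v = v ≡ a ⊎ v ≡ b ⊎ X v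

  abstract
    adjoin : ∀ {X k a b} → a ~ b → ¬ X a → ¬ X b → Matching X k → Matching (Adjoin X a b) (suc k)
    adjoin {X} {_} {a} {b} e ¬xa ¬xb m = add e (inj₁ refl) (inj₂ (inj₁ refl)) (resp into out m)
      where
      into : X ⊑ (Adjoin X a b - a - b)
      into x = (inj₂ (inj₂ x) , λ { refl → ¬xa x }) , λ { refl → ¬xb x }
      out : (Adjoin X a b - a - b) ⊑ X
      out ((inj₁ p , q) , _) = contradiction p q
      out ((inj₂ (inj₁ p) , _) , q) = contradiction p q
      out ((inj₂ (inj₂ x) , _) , _) = x

    union : ∀ {X Y : VSet} {i j} → Matching X i → Matching Y j → (∀ {v} → X v → ¬ Y v)
          → Matching (X ∪ Y) (i + j)
    union (empty e) m′ _ = resp inj₂ [ ⊥-elim ∘ e , id ]′ m′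
    union (add e xa xb m) m′ disj =
      add e (inj₁ xa) (inj₁ xb)
        (resp (λ { (inj₁ ((x , p) , q)) → (inj₁ x , p) , q
                 ; (inj₂ y) → (inj₂ y , λ { refl → disj xa y }) , λ { refl → disj xb y } })
              (λ { ((inj₁ x , p) , q) → inj₁ ((x , p) , q) ; ((inj₂ y , _) , _) → inj₂ y })
              (union m m′ (disj ∘ proj₁ ∘ proj₁)))

    -- The edges of a matching are disjoint, so the one at `v` can be moved to the front. The
    -- equation on `k` exposes the successor when the caller matches on it.
    mate : ∀ {X k v} → Matching X k → X v
         → ∃ λ w → ∃ λ j → v ~ w × X w × k ≡ suc j × Matching (X - v - w) j
    mate (empty e) xv = ⊥-elim (e xv)
    mate {v = v} (add {a} {b} e xa xb m) xv with v ≟ a | v ≟ b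
    ... | yes refl | _ = b , _ , e , xb , refl , m
    ... | no _ | yes refl =
      a , _ , ~-sym e , xa , refl , resp (λ ((x , p) , q) → (x , q) , p) (λ ((x , p) , q) → (x , q) , p) m
    ... | no v≢a | no v≢b with mate m ((xv , v≢a) , v≢b)
    ... | w , j , vw , ((xw , w≢a) , w≢b) , refl , m′ =
      w , _ , vw , xw , refl ,
      add e ((xa , ≢-sym v≢a) , ≢-sym w≢a) ((xb , ≢-sym v≢b) , ≢-sym w≢b)
        (resp (λ ((((x , p) , q) , r) , s) → (((x , r) , s) , p) , q)
              (λ ((((x , r) , s) , p) , q) → (((x , p) , q) , r) , s) m′)

  -- The matching as an involution; that `f` undoes itself later makes the pairing of the two sides
  -- injective.
  partner : ∀ {X k} → Matching X k
          → ∃ λ (f : V → V) → ∀ v → X v → X (f v) × v ~ f v × f (f v) ≡ v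
  partner (empty e) = id , λ v xv → ⊥-elim (e xv)
  partner {X} (add {a} {b} e xa xb m) = f , spec
    where
    g = proj₁ (partner m)
    f : V → V
    f v with v ≟ a | v ≟ b
    ... | yes _ | _ = b
    ... | no _ | yes _ = a
    ... | no _ | no _ = g v
    fa : f a ≡ b
    fa with a ≟ a | a ≟ b
    ... | yes _ | _ = refl
    ... | no ne | _ = contradiction refl ne
    fb : f b ≡ a
    fb with b ≟ a | b ≟ b
    ... | yes p | _ = p
    ... | no _ | yes _ = refl
    ... | no _ | no ne = contradiction refl ne
    fg : ∀ {v} → v ≢ a → v ≢ b → f v ≡ g v
    fg {v} p q with v ≟ a | v ≟ b
    ... | yes r | _ = contradiction r p
    ... | no _ | yes r = contradiction r q
    ... | no _ | no _ = refl
    spec : ∀ v → X v → X (f v) × v ~ f v × f (f v) ≡ v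
    spec v xv = cases (v ≟ a) (v ≟ b)
      where
      cases : Dec (v ≡ a) → Dec (v ≡ b) → X (f v) × v ~ f v × f (f v) ≡ v
      cases (yes refl) _ = subst X (≡-sym fa) xb , subst (v ~_) (≡-sym fa) e , trans (cong f fa) fb
      cases (no _) (yes refl) =
        subst X (≡-sym fb) xa , subst (v ~_) (≡-sym fb) (~-sym e) , trans (cong f fb) fa
      cases (no v≢a) (no v≢b) with proj₂ (partner m) v ((xv , v≢a) , v≢b)
      ... | ((xg , g≢a) , g≢b) , vg , gg =
        subst X (≡-sym (fg v≢a v≢b)) xg , subst (v ~_) (≡-sym (fg v≢a v≢b)) vg ,
        trans (cong f (fg v≢a v≢b)) (trans (fg g≢a g≢b) gg)

  Indep : VSet → Set
  Indep W = ∀ {a b} → W a → W b → ¬ a ~ b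

  record MaxM (W X : VSet) (k : ℕ) : Set where
    constructor maxM
    field
      matching : Matching X k
      inside   : X ⊑ W
      free     : Indep (W ∖ X)
  open MaxM public

  private
    greedy : ∀ {W : VSet} → Decidable W → (es : List (V × V))
           → ∃ λ X → ∃ λ k → Matching X k × X ⊑ W
           × (∀ {a b} → (a , b) ∈ es → (W ∖ X) a → (W ∖ X) b → ¬ a ~ b)
    greedy W? [] = ∅ , 0 , empty (λ ()) , (λ ()) , λ ()
    greedy {W} W? ((a , b) ∷ es) with greedy W? es
    ... | X , k , m , sub , fr
      with a ~? b ×-dec ∖-dec W? (matched? m) a ×-dec ∖-dec W? (matched? m) b
    ... | yes (ab , (wa , ¬xa) , (wb , ¬xb)) =
      Adjoin X a b , suc k , adjoin ab ¬xa ¬xb m ,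
      (λ { (inj₁ refl) → wa ; (inj₂ (inj₁ refl)) → wb ; (inj₂ (inj₂ x)) → sub x }) ,
      λ { (here refl) (_ , ¬x) _ _ → ¬x (inj₁ refl)
        ; (there e) (wc , ¬xc) (wd , ¬xd) → fr e (wc , ¬xc ∘ inj₂ ∘ inj₂) (wd , ¬xd ∘ inj₂ ∘ inj₂) }
    ... | no ¬p = X , k , m , sub ,
      λ { (here refl) p q ab → ¬p (ab , p , q) ; (there e) → fr e }

  abstract
    maximal : ∀ {W : VSet} → Decidable W → ∃ λ X → ∃ λ k → MaxM W X k
    maximal W? with greedy W? (cartesianProduct (allFin n) (allFin n))
    ... | X , k , m , sub , fr =
      X , k , maxM m sub (fr (∈-cartesianProduct⁺ (∈-allFin _) (∈-allFin _)))

  MaxM-adjoin : ∀ {W X : VSet} {a b k} → a ~ b → W a → W b → MaxM (W - a - b) X k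
              → MaxM W (Adjoin X a b) (suc k)
  MaxM-adjoin {W} {X} {a} {b} e wa wb (maxM m sub fr) = maxM
    (adjoin e (λ x → proj₂ (proj₁ (sub x)) refl) (λ x → proj₂ (sub x) refl) m)
    (λ { (inj₁ refl) → wa ; (inj₂ (inj₁ refl)) → wb ; (inj₂ (inj₂ x)) → proj₁ (proj₁ (sub x)) })
    (λ p q → fr (lem p) (lem q))
    where
    lem : (W ∖ Adjoin X a b) ⊑ ((W - a - b) ∖ X)
    lem (wv , ¬x) = ((wv , ¬x ∘ inj₁) , ¬x ∘ inj₂ ∘ inj₁) , ¬x ∘ inj₂ ∘ inj₂

  -- A minimal edge dominating set of G[W] of size k: minimality is expressed by a
  -- private edge of each member, i.e. an edge dominated by that member only.
  record EDS (W : VSet) (k : ℕ) : Set where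
    constructor eds
    field
      edge  : Fin k → V × V
      valid : ∀ i → W (proj₁ (edge i)) × W (proj₂ (edge i)) × proj₁ (edge i) ~ proj₂ (edge i)
      dom   : ∀ {u v} → W u → W v → u ~ v → ∃ λ i → SharesEndpoint u v (edge i)
      priv  : ∀ i → ∃ λ u → ∃ λ v → W u × W v × u ~ v
                × (∀ j → SharesEndpoint u v (edge j) → j ≡ i)

  meets : ∀ {W : VSet} {u v} {e : V × V} → SharesEndpoint u v e
        → W (proj₁ e) → W (proj₂ e) → W u ⊎ W v
  meets (inj₁ refl) wa wb = inj₁ wa
  meets (inj₂ (inj₁ refl)) wa wb = inj₂ wa
  meets (inj₂ (inj₂ (inj₁ refl))) wa wb = inj₁ wb
  meets (inj₂ (inj₂ (inj₂ refl))) wa wb = inj₂ wb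

  abstract
    eds-cons : ∀ {W : VSet} {a b k} → W a → W b → a ~ b → EDS (W - a - b) k → EDS W (suc k)
    eds-cons {W} {a} {b} {k} wa wb ab (eds edge valid dom priv) = eds edge′ valid′ dom′ priv′
      where
      edge′ : Fin (suc k) → V × V
      edge′ zero = a , b
      edge′ (suc i) = edge i
      valid′ : ∀ i → W (proj₁ (edge′ i)) × W (proj₂ (edge′ i)) × proj₁ (edge′ i) ~ proj₂ (edge′ i)
      valid′ zero = wa , wb , ab
      valid′ (suc i) with valid i
      ... | ((p , _) , _) , ((q , _) , _) , e = p , q , e
      dom′ : ∀ {u v} → W u → W v → u ~ v → ∃ λ i → SharesEndpoint u v (edge′ i)
      dom′ {u} {v} wu wv uv with u ≟ a | u ≟ b | v ≟ a | v ≟ b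
      ... | yes p | _ | _ | _ = zero , inj₁ (≡-sym p)
      ... | _ | yes p | _ | _ = zero , inj₂ (inj₂ (inj₁ (≡-sym p)))
      ... | _ | _ | yes p | _ = zero , inj₂ (inj₁ (≡-sym p))
      ... | _ | _ | _ | yes p = zero , inj₂ (inj₂ (inj₂ (≡-sym p)))
      ... | no p | no q | no r | no s with dom ((wu , p) , q) ((wv , r) , s) uv
      ... | i , sh = suc i , sh
      priv′ : ∀ i → ∃ λ u → ∃ λ v → W u × W v × u ~ v
            × (∀ j → SharesEndpoint u v (edge′ j) → j ≡ i)
      priv′ zero = a , b , wa , wb , ab , only
        where
        only : ∀ j → SharesEndpoint a b (edge′ j) → j ≡ zero
        only zero _ = refl
        only (suc j) sh with meets {W - a - b} sh (proj₁ (valid j)) (proj₁ (proj₂ (valid j)))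
        ... | inj₁ ((_ , p) , _) = contradiction refl p
        ... | inj₂ (_ , p) = contradiction refl p
      priv′ (suc i) with priv i
      ... | u , v , ((wu , u≢a) , u≢b) , ((wv , v≢a) , v≢b) , uv , only = u , v , wu , wv , uv , only′
        where
        only′ : ∀ j → SharesEndpoint u v (edge′ j) → j ≡ suc i
        only′ zero (inj₁ p) = contradiction (≡-sym p) u≢a
        only′ zero (inj₂ (inj₁ p)) = contradiction (≡-sym p) v≢a
        only′ zero (inj₂ (inj₂ (inj₁ p))) = contradiction (≡-sym p) u≢b
        only′ zero (inj₂ (inj₂ (inj₂ p))) = contradiction (≡-sym p) v≢b
        only′ (suc j) sh = cong suc (only j sh)

    -- Vertices of `W′` outside `W` are isolated in G[`W′`], so they affect neither domination nor
    -- private edges.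
    eds-ext : ∀ {W W′ : VSet} {k} → W ⊑ W′ → (∀ {a b} → W′ a → W′ b → a ~ b → W a)
            → EDS W k → EDS W′ k
    eds-ext sub edges (eds edge valid dom priv) = eds edge
      (λ i → let (p , q , e) = valid i in sub p , sub q , e)
      (λ wu wv uv → dom (edges wu wv uv) (edges wv wu (~-sym uv)) uv)
      (λ i → let (u , v , wu , wv , uv , only) = priv i in u , v , sub wu , sub wv , uv , only)

    -- Each matching edge is its own private edge. All later counts use this: after a matching is
    -- fixed, any minimal edge dominating set of what remains may be chosen, whether or not it is a
    -- matching.
    eds-matching : ∀ {W X : VSet} {i j} → Matching X i → X ⊑ W → EDS (W ∖ X) j → EDS W (i + j)
    eds-matching (empty e) sub F = eds-ext proj₁ (λ w _ _ → w , e) F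
    eds-matching {W} (add {a} {b} e xa xb m) sub F =
      eds-cons (sub xa) (sub xb) e
        (eds-matching m (λ ((x , p) , q) → (sub x , p) , q)
          (eds-ext (λ (w , ¬x) → ((w , λ { refl → ¬x xa }) , λ { refl → ¬x xb }) , ¬x ∘ proj₁ ∘ proj₁)
                   (λ (((w , p) , q) , ¬x) _ _ → w , λ x → ¬x ((x , p) , q)) F))

    eds-indep : ∀ {W : VSet} → Indep W → EDS W 0
    eds-indep ind = eds (λ ()) (λ ()) (λ wu wv uv → ⊥-elim (ind wu wv uv)) (λ ())

    eds-maximal : ∀ {W X : VSet} {k} → MaxM W X k → EDS W k
    eds-maximal {k = k} (maxM m sub fr) =
      subst (EDS _) (+-identityʳ k) (eds-matching m sub (eds-indep fr))

  Uniform : VSet → ℕ → Set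
  Uniform W k = ∀ {j} → EDS W j → j ≡ k

  abstract
    private
      extension : ∀ {W X : VSet} {k j} → Decidable W → Uniform W k → Matching X j → X ⊑ W
                → ∃ λ Y → ∃ λ i → MaxM (W ∖ X) Y i × j + i ≡ k
      extension W? unif m sub with maximal (∖-dec W? (matched? m))
      ... | Y , i , mx = Y , i , mx , unif (eds-matching m sub (eds-maximal mx))

    matching-≤ : ∀ {W X : VSet} {k j} → Decidable W → Uniform W k → Matching X j → X ⊑ W → j ≤ k
    matching-≤ {j = j} W? unif m sub with extension W? unif m sub
    ... | _ , i , _ , refl = m≤m+n j i

    full⇒maximal : ∀ {W X : VSet} {k} → Decidable W → Uniform W k → Matching X k → X ⊑ W → MaxM W X k
    full⇒maximal {W} {X} {k} W? unif m sub = maxM m sub λ (wa , ¬xa) (wb , ¬xb) ab →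
      1+n≰n (matching-≤ W? unif (adjoin ab ¬xa ¬xb m)
        λ { (inj₁ refl) → wa ; (inj₂ (inj₁ refl)) → wb ; (inj₂ (inj₂ x)) → sub x })

    -- The matching extends to a maximal one of size `k`; since `j` differs from `k`, the extension
    -- contributes an edge.
    augment : ∀ {W X : VSet} {k j} → Decidable W → Uniform W k → Matching X j → X ⊑ W → j ≢ k
            → ∃ λ a → ∃ λ b → a ~ b × (W ∖ X) a × (W ∖ X) b
    augment {j = j} W? unif m sub j≢k with extension W? unif m sub
    ... | _ , .0 , maxM (empty _) _ _ , eq = contradiction (trans (≡-sym (+-identityʳ j)) eq) j≢k
    ... | _ , _ , maxM (add ab ya yb _) inside _ , _ = _ , _ , ab , inside ya , inside yb

-- Reducing a dominating family to a minimal one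

module Minimisation {n : ℕ} (G : Graph n) where

  open EdgeDomination G

  shares? : ∀ u v e → Dec (SharesEndpoint {n} u v e)
  shares? u v (a , b) = (a ≟ u) ⊎-dec (a ≟ v) ⊎-dec (b ≟ u) ⊎-dec (b ≟ v)

  Valid : VSet → V × V → Set
  Valid W (a , b) = W a × W b × a ~ b

  Dominating : VSet → ∀ {k} → (Fin k → V × V) → Set
  Dominating W edge = ∀ {u v} → W u → W v → u ~ v → ∃ λ i → SharesEndpoint u v (edge i)

  Private : VSet → ∀ {k} → (Fin k → V × V) → Fin k → Set
  Private W edge i = ∃ λ u → ∃ λ v → W u × W v × u ~ v
                   × (∀ j → SharesEndpoint u v (edge j) → j ≡ i)

  private? : ∀ {W : VSet} {k} → Decidable W → (edge : Fin k → V × V) → Decidable (Private W edge)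
  private? W? edge i = any? λ u → any? λ v → W? u ×-dec W? v ×-dec (u ~? v)
    ×-dec all? (λ j → shares? u v (edge j) →-dec (j ≟ i))

  minimise : ∀ {W : VSet} {P : V × V → Set} → Decidable W → ∀ k (edge : Fin k → V × V)
    → (∀ i → Valid W (edge i)) → Dominating W edge → (∀ i → P (edge i))
    → ∃ λ j → Σ (EDS W j) λ F → ∀ i → P (EDS.edge F i)
  minimise {W} {P} W? k edge valid dom all-P with all? (private? W? edge)
  ... | yes priv = k , eds edge valid dom priv , all-P
  minimise {W} {P} W? zero edge valid dom all-P | no ¬priv = ⊥-elim (¬priv (λ ()))
  minimise {W} {P} W? (suc k) edge valid dom all-P | no ¬priv with ¬∀⟶∃¬ _ _ (private? W? edge) ¬priv
  ... | i , ¬privᵢ = minimise {P = P} W? k (edge ∘ punchIn i) (valid ∘ punchIn i) dom′ (all-P ∘ punchIn i)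
    where
    dom′ : Dominating W (edge ∘ punchIn i)
    dom′ {u} {v} wu wv uv with any? (λ j → ¬? (i ≟ j) ×-dec shares? u v (edge j))
    ... | yes (j , i≢j , sh) =
      punchOut i≢j , subst (SharesEndpoint u v ∘ edge) (≡-sym (punchIn-punchOut i≢j)) sh
    ... | no ¬∃ = ⊥-elim (¬privᵢ (u , v , wu , wv , uv , only))
      where
      only : ∀ j → SharesEndpoint u v (edge j) → j ≡ i
      only j sh with i ≟ j
      ... | yes refl = refl
      ... | no i≢j = contradiction (j , i≢j , sh) ¬∃

  -- The edges of G[W] avoiding c dominate G[W] when every neighbour of c has another neighbour.
  avoiding : ∀ {W : VSet} {c} → Decidable W → (∀ {d} → W d → c ~ d → ∃ λ a → W a × d ~ a × a ≢ c)
    → ∃ λ j → Σ (EDS W j) λ F → ∀ i → proj₁ (EDS.edge F i) ≢ c × proj₂ (EDS.edge F i) ≢ c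
  avoiding {W} {c} W? other =
    minimise {P = λ (a , b) → a ≢ c × b ≢ c} W? (length es) (lookup es) (proj₁ ∘ good) dom (proj₂ ∘ good)
    where
    Good : V × V → Set
    Good (a , b) = Valid W (a , b) × a ≢ c × b ≢ c
    good? : Decidable Good
    good? (a , b) = (W? a ×-dec W? b ×-dec (a ~? b)) ×-dec ¬? (a ≟ c) ×-dec ¬? (b ≟ c)
    es : List (V × V)
    es = filter good? (cartesianProduct (allFin n) (allFin n))
    good : ∀ i → Good (lookup es i)
    good i = proj₂ (∈-filter⁻ good? {xs = cartesianProduct (allFin n) (allFin n)} (∈-lookup i))
    locate : ∀ {a b} → Good (a , b) → ∃ λ i → (a , b) ≡ lookup es i
    locate g = index e∈ , Anyₚ.lookup-index e∈
      where e∈ = ∈-filter⁺ good? (∈-cartesianProduct⁺ (∈-allFin _) (∈-allFin _)) g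
    dom : Dominating W (lookup es)
    dom {u} {v} wu wv uv with u ≟ c | v ≟ c
    ... | no u≢c | no v≢c with locate ((wu , wv , uv) , u≢c , v≢c)
    ...   | i , e = i , inj₁ (cong proj₁ (≡-sym e))
    dom {u} {v} wu wv uv | yes refl | _ with other wv uv
    ... | a , wa , va , a≢c with locate ((wv , wa , va) , ≢-sym (~⇒≢ uv) , a≢c)
    ...   | i , e = i , inj₂ (inj₁ (cong proj₁ (≡-sym e)))
    dom {u} {v} wu wv uv | no u≢c | yes refl with other wu (~-sym uv)
    ... | a , wa , ua , a≢c with locate ((wu , wa , ua) , u≢c , a≢c)
    ...   | i , e = i , inj₁ (cong proj₁ (≡-sym e))

-- The bipartition by missable vertices

module Bipartition {n : ℕ} (G : Graph n) where

  open EdgeDomination G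

  Reach : VSet → V → V → Set
  Reach P u v = ReachIn G P u v

  reach-start : ∀ {P u v} → Reach P u v → P u
  reach-start (here p) = p
  reach-start (step p _ _) = p

  reach-end : ∀ {P u v} → Reach P u v → P v
  reach-end (here p) = p
  reach-end (step _ _ r) = reach-end r

  reach-snoc : ∀ {P u v w} → Reach P u v → v ~ w → P w → Reach P u w
  reach-snoc (here p) e q = step p e (here q)
  reach-snoc (step p f r) e q = step p f (reach-snoc r e q)

  private
    -- The walk is cut at its last visit to `z`, so what follows the next edge never returns there.
    last-visit : ∀ {P a u} z → Reach P a u
               → Reach (P - z) a u ⊎ u ≡ z ⊎ ∃ λ c → z ~ c × Reach (P - z) c u
    last-visit {a = a} z (here p) with a ≟ z
    ... | yes a≡z = inj₂ (inj₁ a≡z)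
    ... | no a≢z = inj₁ (here (p , a≢z))
    last-visit {a = a} z (step p e r) with last-visit z r | a ≟ z
    ... | inj₂ found | _ = inj₂ found
    ... | inj₁ r′ | yes refl = inj₂ (inj₂ (_ , e , r′))
    ... | inj₁ r′ | no a≢z = inj₁ (step (p , a≢z) e r′)

  reach-split : ∀ {P z u} → Reach P z u → u ≡ z ⊎ ∃ λ c → z ~ c × Reach (P - z) c u
  reach-split {z = z} r with last-visit z r
  ... | inj₁ r′ = contradiction refl (proj₂ (reach-start r′))
  ... | inj₂ found = found

  TriangleFree : VSet → Set
  TriangleFree W = ∀ {a b c} → W a → W b → W c → a ~ b → b ~ c → ¬ a ~ c

  Missable : VSet → V → Set₁
  Missable W v = ∃ λ X → ∃ λ k → MaxM W X k × ¬ X v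

  full⇒missable : ∀ {W X k v} → Decidable W → Uniform W k → Matching X k → X ⊑ W → ¬ X v
                → Missable W v
  full⇒missable W? unif m sub ¬xv = _ , _ , full⇒maximal W? unif m sub , ¬xv

  root-missable : ∀ {W k z} → Decidable W → Uniform W k → Uniform (W - z) k → Missable W z
  root-missable {z = z} W? unif unif-z with maximal (-‿dec W? z)
  ... | X , j , mx with unif-z (eds-maximal mx)
  ... | refl =
    full⇒missable W? unif (matching mx) (proj₁ ∘ inside mx) (λ xz → proj₂ (inside mx xz) refl)

  private
    -- Trading z c′ for c′ d keeps the size and hence maximality, yet leaves both ends of z c
    -- unsaturated. The exception d = c closes the triangle z c c′.
    rematch : ∀ {W X j z c c′ d} → Decidable W → TriangleFree W → Uniform W (suc j)
            → W z → W c → X ⊑ W → z ~ c → z ~ c′ → ¬ X c → X c′ → Matching (X - z - c′) j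
            → W d → d ≢ z → ¬ (X - z - c′) d → ¬ c′ ~ d
    rematch {W} {X} {j} {z} {c} {c′} {d} W? tf unif wz wc sub zc zc′ ¬xc xc′ m′ wd d≢z ¬d c′d =
      avoid (c ≟ d)
      where
      mx : MaxM W (Adjoin (X - z - c′) c′ d) (suc j)
      mx = full⇒maximal W? unif (adjoin c′d (λ (_ , p) → p refl) ¬d m′)
        λ { (inj₁ refl) → sub xc′ ; (inj₂ (inj₁ refl)) → wd ; (inj₂ (inj₂ ((x , _) , _))) → sub x }
      avoid : Dec (c ≡ d) → ⊥
      avoid (yes refl) = tf wz (sub xc′) wc zc′ c′d zc
      avoid (no c≢d) = free mx
        (wz , λ { (inj₁ refl) → ~⇒≢ zc′ refl ; (inj₂ (inj₁ refl)) → d≢z refl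
                ; (inj₂ (inj₂ ((_ , p) , _))) → p refl })
        (wc , λ { (inj₁ refl) → ¬xc xc′ ; (inj₂ (inj₁ p)) → c≢d p
                ; (inj₂ (inj₂ ((x , _) , _))) → ¬xc x }) zc

  -- If a maximal matching misses c, it contains an edge zc′, and the maximum matching of W − z
  -- obtained by rematching c′ has to saturate c; this closes the triangle z c c′.
  nbr-unmissable : ∀ {W k z c} → Decidable W → TriangleFree W → W z
                 → Uniform W k → Uniform (W - z) k → W c → z ~ c → ¬ Missable W c
  nbr-unmissable {W} {k} {z} {c} W? tf wz unif unif-z wc zc (X , j , mx , ¬xc)
    with unif (eds-maximal mx) | matched? (matching mx) z
  ... | refl | no ¬xz = free mx (wz , ¬xz) (wc , ¬xc) zc
  ... | refl | yes xz with mate (matching mx) xz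
  ... | c′ , j′ , zc′ , xc′ , refl , m′
    with augment (-‿dec W? z) unif-z m′ (λ ((x , x≢z) , _) → inside mx x , x≢z) (≢-sym 1+n≢n)
  ... | a , b , ab , ((wa , a≢z) , ¬a) , ((wb , b≢z) , ¬b) with a ≟ c′ | b ≟ c′
  ... | no a≢c′ | no b≢c′ =
    free mx (wa , λ x → ¬a ((x , a≢z) , a≢c′)) (wb , λ x → ¬b ((x , b≢z) , b≢c′)) ab
  ... | yes refl | _ =
    rematch W? tf unif wz wc (inside mx) zc zc′ ¬xc xc′ m′ wb b≢z ¬b ab
  ... | no _ | yes refl =
    rematch W? tf unif wz wc (inside mx) zc zc′ ¬xc xc′ m′ wa a≢z ¬a (~-sym ab)

  ExactlyOneMissable : VSet → V → V → Set₁
  ExactlyOneMissable W u v =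
    (Missable W u × ¬ Missable W v) ⊎ (¬ Missable W u × Missable W v)

  private
    Claim : ℕ → Set₁
    Claim k = ∀ {W z} → Decidable W → TriangleFree W → W z → Uniform W k → Uniform (W - z) k
            → ∀ {u v} → Reach W z u → W v → u ~ v → ExactlyOneMissable W u v

    -- The edge z c can be added to the matchings of W − z − c, and c d to those of W − z − c − d,
    -- so (W − z − c , d) inherits the hypotheses on (W , z) with k decreased by one.
    claim-step : ∀ k → Claim k → Claim (suc k)
    claim-step k claim {W} {z} W? tf wz unif unif-z {u} {v} walk wv uv =
      by-split (reach-split walk)
      where
      z-missable : Missable W z
      z-missable = root-missable W? unif unif-z

      nbr : ∀ {c} → W c → z ~ c → ¬ Missable W c
      nbr = nbr-unmissable W? tf wz unif unif-z

      module _ {c} (wc : W c) (zc : z ~ c) where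

        W′ : VSet
        W′ = W - z - c

        W′? : Decidable W′
        W′? = -‿dec (-‿dec W? z) c

        unif′ : Uniform W′ k
        unif′ F = ℕₚ.suc-injective (unif (eds-cons wz wc zc F))

        lift : ∀ {w} → W′ w → Missable W′ w → Missable W w
        lift ((_ , w≢z) , w≢c) (X , j , mx , ¬xw) = _ , _ , MaxM-adjoin zc wz wc mx ,
          λ { (inj₁ p) → w≢z p ; (inj₂ (inj₁ p)) → w≢c p ; (inj₂ (inj₂ x)) → ¬xw x }

        module _ {d} (w′d : W′ d) (cd : c ~ d) where

          unif″ : Uniform (W′ - d) k
          unif″ F = ℕₚ.suc-injective (unif-z (eds-cons (wc , ≢-sym (~⇒≢ zc)) (proj₁ w′d) cd F))

          d-missable : Missable W d
          d-missable = lift w′d (root-missable W′? unif′ unif″)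

          IH : ∀ {u v} → Reach W′ d u → W′ v → u ~ v → ExactlyOneMissable W′ u v
          IH = claim W′?
            (λ ((a , _) , _) ((b , _) , _) ((c , _) , _) → tf a b c) w′d unif′ unif″

          -- Suppose a maximal matching X of `W` misses w. It saturates c. Unless X has two
          -- different edges at c and at z, discarding the edge at c leaves k edges inside `W′` that
          -- miss w. In the remaining case both edges are discarded and one is regained by
          -- augmenting in `W′`.
          descend : ∀ {w} → Reach W′ d w → ¬ Missable W′ w → ¬ Missable W w
          descend {w} r ¬M (X , j , mx , ¬xw) with unif (eds-maximal mx) | matched? (matching mx) c
          ... | refl | no ¬xc = nbr wc zc (X , _ , mx , ¬xc)
          ... | refl | yes xc with mate (matching mx) xc
          ... | c⁺ , _ , cc⁺ , xc⁺ , refl , m₁ with c⁺ ≟ z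
          ... | yes refl = ¬M (full⇒missable W′? unif′ m₁
                  (λ ((x , p) , q) → (inside mx x , q) , p) (¬xw ∘ proj₁ ∘ proj₁))
          ... | no c⁺≢z with matched? m₁ z
          ... | no ¬xz = ¬M (full⇒missable W′? unif′ m₁
                  (λ x₁@((x , p) , _) → (inside mx x , λ { refl → ¬xz x₁ }) , p) (¬xw ∘ proj₁ ∘ proj₁))
          ... | yes xz with mate m₁ xz
          ... | z⁺ , _ , zz⁺ , ((xz⁺ , z⁺≢c) , z⁺≢c⁺) , refl , m₂
            with augment W′? unif′ m₂
                   (λ ((((x , p) , _) , q) , _) → (inside mx x , q) , p) (≢-sym 1+n≢n)
          ... | a , b , ab , (w′a , ¬a) , (w′b , ¬b) = stuck (w ≟ a) (w ≟ b)
            where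
            -- The regained edge cannot end at w. If it is w c⁺, it could replace c c⁺ and free c, a
            -- neighbour of z. If it is w z⁺, the induction hypothesis makes z⁺ missable, again a
            -- neighbour of z. Otherwise X would leave it free.
            hit : ∀ {e} → W′ e → ¬ (X - c - c⁺ - z - z⁺) e → ¬ w ~ e
            hit {e} ((we , e≢z) , e≢c) ¬e we~ with e ≟ c⁺ | e ≟ z⁺
            ... | yes refl | _ = nbr wc zc (full⇒missable W? unif
                    (adjoin we~ (¬xw ∘ proj₁ ∘ proj₁) (λ (_ , p) → p refl) m₁)
                    (λ { (inj₁ refl) → proj₁ (proj₁ (reach-end r)) ; (inj₂ (inj₁ refl)) → we
                       ; (inj₂ (inj₂ ((x , _) , _))) → inside mx x })
                    (λ { (inj₁ p) → proj₂ (reach-end r) (≡-sym p) ; (inj₂ (inj₁ p)) → ~⇒≢ cc⁺ p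
                       ; (inj₂ (inj₂ ((_ , p) , _))) → p refl }))
            ... | no _ | yes refl with IH r ((inside mx xz⁺ , e≢z) , e≢c) we~
            ... | inj₁ (M , _) = ¬M M
            ... | inj₂ (_ , M) = nbr we zz⁺ (lift ((we , e≢z) , e≢c) M)
            hit {e} ((we , e≢z) , e≢c) ¬e we~ | no p | no q =
              free mx (proj₁ (proj₁ (reach-end r)) , ¬xw)
                      (we , λ x → ¬e ((((x , e≢c) , p) , e≢z) , q)) we~
            stuck : Dec (w ≡ a) → Dec (w ≡ b) → ⊥
            stuck (yes refl) _ = hit w′b ¬b ab
            stuck (no _) (yes refl) = hit w′a ¬a (~-sym ab)
            stuck (no w≢a) (no w≢b) = ¬M (full⇒missable W′? unif′ (adjoin ab ¬a ¬b m₂)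
              (λ { (inj₁ refl) → w′a ; (inj₂ (inj₁ refl)) → w′b
                 ; (inj₂ (inj₂ ((((x , p) , _) , q) , _))) → (inside mx x , q) , p })
              (λ { (inj₁ p) → w≢a p ; (inj₂ (inj₁ p)) → w≢b p
                 ; (inj₂ (inj₂ ((((x , _) , _) , _) , _))) → ¬xw x }))

      by-split : u ≡ z ⊎ (∃ λ c → z ~ c × Reach (W - z) c u) → ExactlyOneMissable W u v
      by-split (inj₁ refl) = inj₁ (z-missable , nbr wv uv)
      by-split (inj₂ (c , zc , r)) with proj₁ (reach-start r) | reach-split r
      ... | wc | inj₁ refl = inj₂ (nbr wc zc , v-missable (v ≟ z))
        where
        v-missable : Dec (v ≡ z) → Missable W v
        v-missable (yes refl) = z-missable
        v-missable (no v≢z) = d-missable wc zc ((wv , v≢z) , ≢-sym (~⇒≢ uv)) uv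
      ... | wc | inj₂ (d , cd , r′) = cases (v ≟ z) (v ≟ c)
        where
        w′d = reach-start r′
        w′u = reach-end r′
        cases : Dec (v ≡ z) → Dec (v ≡ c) → ExactlyOneMissable W u v
        cases (yes refl) _ = inj₂ (nbr (proj₁ (proj₁ w′u)) (~-sym uv) , z-missable)
        cases (no _) (yes refl) = inj₁ (d-missable wc zc w′u (~-sym uv) , nbr wc zc)
        cases (no v≢z) (no v≢c) with IH wc zc w′d cd r′ ((wv , v≢z) , v≢c) uv
        ... | inj₁ (M , ¬M) = inj₁ (lift wc zc w′u M ,
                descend wc zc w′d cd (reach-snoc r′ uv ((wv , v≢z) , v≢c)) ¬M)
        ... | inj₂ (¬M , M) = inj₂ (descend wc zc w′d cd r′ ¬M ,
                lift wc zc ((wv , v≢z) , v≢c) M)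

  exactly-one-missable : ∀ k → Claim k
  exactly-one-missable zero W? tf wz unif unif-z {u} {v} r wv uv
    with maximal (-‿dec (-‿dec W? u) v)
  ... | _ , _ , mx with unif (eds-cons (reach-end r) wv uv (eds-maximal mx))
  ... | ()
  exactly-one-missable (suc k) = claim-step k (exactly-one-missable k)

-- The two sides of z

module Cut {n : ℕ} (G : Graph n) where

  open EdgeDomination G
  open Bipartition G

  Full : VSet
  Full _ = ⊤

  -- Symmetric in x and y, so that `swap` turns every result about x into one about y. Uniqueness of
  -- the triangle is stored as a condition on the last vertex only; rotating a triangle gives it for
  -- the others.
  record Setup (x y z : V) : Set₁ where
    field
      S       : VSet
      S?      : Decidable S
      Sx      : S x
      Sy      : S y
      ¬Sz     : ¬ S z
      cut     : ∀ {a b} → S a → a ~ b → b ≢ z → S b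
      x~y     : x ~ y
      x~z     : x ~ z
      y~z     : y ~ z
      tri     : ∀ {a b c} → a ~ b → b ~ c → a ~ c → c ≢ x → c ≢ y → c ≢ z → ⊥
      conn    : ∀ {v} → S v → Reach (_≢ z) x v
      c₀      : V
      c₀∉S    : ¬ S c₀
      c₀≢z    : c₀ ≢ z
      c₀~z    : c₀ ~ z
      K       : ℕ
      uniform : Uniform Full K

  swap : ∀ {x y z} → Setup x y z → Setup y x z
  swap s = record
    { S = S ; S? = S? ; Sx = Sy ; Sy = Sx ; ¬Sz = ¬Sz ; cut = cut ; x~y = ~-sym x~y
    ; x~z = y~z ; y~z = x~z ; tri = λ p q r a b → tri p q r b a
    ; conn = λ Sv → step (~⇒≢ y~z) (~-sym x~y) (conn Sv)
    ; c₀ = c₀ ; c₀∉S = c₀∉S ; c₀≢z = c₀≢z ; c₀~z = c₀~z ; K = K ; uniform = uniform }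
    where open Setup s

  module Sides {x y z : V} (s : Setup x y z) where

    open Setup s

    W D : VSet
    W = ∁ S
    D = W - z

    W? : Decidable W
    W? v = ¬? (S? v)

    D? : Decidable D
    D? = -‿dec W? z

    S⇒≢z : ∀ {v} → S v → v ≢ z
    S⇒≢z Sv refl = ¬Sz Sv

    S≁D : ∀ {a b} → S a → D b → ¬ a ~ b
    S≁D Sa (b∉S , b≢z) ab = b∉S (cut Sa ab b≢z)

    c₀∈D : D c₀
    c₀∈D = c₀∉S , c₀≢z

    abstract
      private
        -- Once z w and the matching of `P` are removed, no edge touches `P`: its free vertices are
        -- independent and it has no edge to `Q`. So only `Q` remains to be dominated.
        via : ∀ {w P Q Y i j} → z ~ w → MaxM P Y i → (∀ {v} → P v → v ≢ z × v ≢ w)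
            → EDS Q j → (∀ {v} → Q v → v ≢ z × v ≢ w × ¬ P v)
            → (∀ v → v ≢ z → v ≢ w → P v ⊎ Q v) → (∀ {a b} → P a → Q b → ¬ a ~ b)
            → suc (i + j) ≡ K
        via {w} {P} {Q} {Y} zw mx P≢ F Q≢ cover sep =
          uniform (eds-cons tt tt zw
            (eds-matching (matching mx)
              (λ y → let (p , q) = P≢ (inside mx y) in (tt , p) , q)
              (eds-ext (λ q → let (q≢z , q≢w , ¬p) = Q≢ q in ((tt , q≢z) , q≢w) , ¬p ∘ inside mx)
                       edges F)))
          where
          edges : ∀ {a b} → ((Full - z - w) ∖ Y) a → ((Full - z - w) ∖ Y) b → a ~ b → Q a
          edges {a} {b} (((_ , a≢z) , a≢w) , ¬ya) (((_ , b≢z) , b≢w) , ¬yb) ab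
            with cover a a≢z a≢w | cover b b≢z b≢w
          ... | inj₂ q | _ = q
          ... | inj₁ p | inj₁ p′ = ⊥-elim (free mx (p , ¬ya) (p′ , ¬yb) ab)
          ... | inj₁ p | inj₂ q = ⊥-elim (sep p q ab)

      via-S : ∀ {s X i j} → S s → s ~ z → MaxM (S - s) X i → EDS D j → suc (i + j) ≡ K
      via-S {s} Ss sz mx F = via (~-sym sz) mx (λ (p , q) → S⇒≢z p , q) F
        (λ (p , q) → q , (λ { refl → p Ss }) , p ∘ proj₁) cover (λ (p , _) q → S≁D p q)
        where
        cover : ∀ v → v ≢ z → v ≢ s → (S - s) v ⊎ D v
        cover v v≢z v≢s with S? v
        ... | yes Sv = inj₁ (Sv , v≢s)
        ... | no v∉S = inj₂ (v∉S , v≢z)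

      via-D : ∀ {c N i j} → D c → c ~ z → MaxM (D - c) N i → EDS S j → suc (i + j) ≡ K
      via-D {c} Dc cz mx F = via (~-sym cz) mx (λ ((_ , p) , q) → p , q) F
        (λ p → S⇒≢z p , (λ { refl → proj₁ Dc p }) , λ q → proj₁ (proj₁ q) p)
        cover (λ (p , _) q ab → S≁D q p (~-sym ab))
        where
        cover : ∀ v → v ≢ z → v ≢ c → (D - c) v ⊎ S v
        cover v v≢z v≢c with S? v
        ... | yes Sv = inj₂ Sv
        ... | no v∉S = inj₁ ((v∉S , v≢z) , v≢c)

      -- Suppose N misses c. Then S and S − x have the same matching number, so some maximum
      -- matching X of S misses x. It contains an edge y y′, and replacing y y′ and z c by the
      -- single edge y z leaves a maximal matching.
      D-saturates : ∀ {N j c} → MaxM D N j → D c → c ~ z → N c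
      D-saturates {N} {j} {c} mN Dc cz with matched? (matching mN) c
      ... | yes Nc = Nc
      ... | no ¬Nc with maximal (-‿dec S? x)
      ... | X , i , mX = ⊥-elim contra
        where
        mN-c : MaxM (D - c) N j
        mN-c = maxM (matching mN) (λ v → inside mN v , λ { refl → ¬Nc v })
          (λ ((p , _) , q) ((p′ , _) , q′) → free mN (p , q) (p′ , q′))
        unif : Uniform S i
        unif F = ℕₚ.suc-injective (+-cancelˡ-≡ j _ _ (trans (+-suc j _)
          (trans (trans (via-D Dc cz mN-c F) (≡-sym (via-S Sx x~z mX (eds-maximal mN))))
                 (trans (cong suc (+-comm i j)) (≡-sym (+-suc j i))))))
        X⊑S : X ⊑ S
        X⊑S = proj₁ ∘ inside mX
        ¬Xx : ¬ X x
        ¬Xx p = proj₂ (inside mX p) refl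
        mX′ : MaxM S X i
        mX′ = full⇒maximal S? unif (matching mX) X⊑S
        contra : ⊥
        contra with matched? (matching mX) y
        ... | no ¬Xy = free mX′ (Sx , ¬Xx) (Sy , ¬Xy) x~y
        ... | yes Xy with mate (matching mX) Xy
        ... | y′ , i₀ , yy′ , Xy′ , refl , m₀ =
          1+n≢n (ℕₚ.suc-injective (trans (via-S Sx x~z mX (eds-maximal mN))
                                      (≡-sym (via-S Sy y~z mX₀ (eds-maximal mN)))))
          where
          Sy′ : S y′
          Sy′ = X⊑S Xy′
          -- If b is x, then x y y′ is a second triangle. Otherwise x, y, y′, b is an augmenting
          -- path: replacing y y′ by x y and y′ b would enlarge a maximum matching.
          y′-free : ∀ {b} → S b → b ≢ y → ¬ (X - y - y′) b → ¬ y′ ~ b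
          y′-free {b} Sb b≢y ¬b y′b with b ≟ x
          ... | yes refl =
            tri x~y yy′ (~-sym y′b) (λ { refl → ¬Xx Xy′ }) (≢-sym (~⇒≢ yy′)) (S⇒≢z Sy′)
          ... | no b≢x = 1+n≰n (matching-≤ S? unif
            (adjoin x~y
              (λ { (inj₁ refl) → ¬Xx Xy′ ; (inj₂ (inj₁ p)) → b≢x (≡-sym p)
                 ; (inj₂ (inj₂ ((p , _) , _))) → ¬Xx p })
              (λ { (inj₁ p) → ~⇒≢ yy′ p ; (inj₂ (inj₁ p)) → b≢y (≡-sym p)
                 ; (inj₂ (inj₂ ((_ , p) , _))) → p refl })
              (adjoin y′b (λ (_ , p) → p refl) ¬b m₀))
            (λ { (inj₁ refl) → Sx ; (inj₂ (inj₁ refl)) → Sy ; (inj₂ (inj₂ (inj₁ refl))) → Sy′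
               ; (inj₂ (inj₂ (inj₂ (inj₁ refl)))) → Sb
               ; (inj₂ (inj₂ (inj₂ (inj₂ ((p , _) , _))))) → X⊑S p }))
          mX₀ : MaxM (S - y) (X - y - y′) i₀
          mX₀ = maxM m₀ (λ ((p , q) , _) → X⊑S p , q) fr
            where
            fr : Indep ((S - y) ∖ (X - y - y′))
            fr {a} {b} ((Sa , a≢y) , ¬a) ((Sb , b≢y) , ¬b) ab with a ≟ y′ | b ≟ y′
            ... | yes refl | _ = y′-free Sb b≢y ¬b ab
            ... | no _ | yes refl = y′-free Sa a≢y ¬a (~-sym ab)
            ... | no p | no q = free mX′ (Sa , λ v → ¬a ((v , a≢y) , p)) (Sb , λ v → ¬b ((v , b≢y) , q)) ab

    N₀ : VSet
    N₀ = proj₁ (maximal D?)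

    ν : ℕ
    ν = proj₁ (proj₂ (maximal D?))

    N₀-maximal : MaxM D N₀ ν
    N₀-maximal = proj₂ (proj₂ (maximal D?))

    X₀ : VSet
    X₀ = proj₁ (maximal S?)

    μ : ℕ
    μ = proj₁ (proj₂ (maximal S?))

    X₀-maximal : MaxM S X₀ μ
    X₀-maximal = proj₂ (proj₂ (maximal S?))

    abstract
      D-uniform : Uniform D ν
      D-uniform F with maximal (-‿dec S? x)
      ... | _ , i , mX = +-cancelˡ-≡ (suc i) _ _
        (trans (via-S Sx x~z mX F) (≡-sym (via-S Sx x~z mX (eds-maximal N₀-maximal))))

      S-uniform : Uniform S μ
      S-uniform F with maximal (-‿dec D? c₀)
      ... | _ , i , mN = +-cancelˡ-≡ (suc i) _ _
        (trans (via-D c₀∈D c₀~z mN F) (≡-sym (via-D c₀∈D c₀~z mN (eds-maximal X₀-maximal))))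

    Full? : Decidable Full
    Full? _ = yes tt

    abstract
      -- If s were missed, z s could be added to X and `N₀`, giving 1 + i + ν edges. A maximal
      -- matching through z c₀ gives K = 1 + l + i, with l the size of a maximal matching of D
      -- without c₀. So l is at least ν, and a maximum matching of D misses c₀, against
      -- `D-saturates`.
      S-saturates : ∀ {X i s} → MaxM S X i → S s → s ~ z → X s
      S-saturates {X} {i} {s} mX Ss sz with matched? (matching mX) s
      ... | yes Xs = Xs
      ... | no ¬Xs with maximal (-‿dec D? c₀)
      ... | N , l , mN = ⊥-elim (proj₂ (inside mN (D-saturates mN′ c₀∈D c₀~z)) refl)
        where
        XN₀ : Matching (Adjoin (X ∪ N₀) z s) (suc (i + ν))
        XN₀ = adjoin (~-sym sz)
          (λ { (inj₁ p) → ¬Sz (inside mX p) ; (inj₂ p) → proj₂ (inside N₀-maximal p) refl })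
          (λ { (inj₁ p) → ¬Xs p ; (inj₂ p) → proj₁ (inside N₀-maximal p) Ss })
          (union (matching mX) (matching N₀-maximal)
            (λ p q → proj₁ (inside N₀-maximal q) (inside mX p)))
        ν≤l : ν ≤ l
        ν≤l = +-cancelˡ-≤ (suc i) _ _ (subst (suc (i + ν) ≤_)
          (trans (≡-sym (via-D c₀∈D c₀~z mN (eds-maximal mX))) (cong suc (+-comm l i)))
          (matching-≤ Full? uniform XN₀ _))
        mN⊑D : N ⊑ D
        mN⊑D p = proj₁ (inside mN p)
        mN′ : MaxM D N l
        mN′ = full⇒maximal D?
          (subst (Uniform D) (≤-antisym ν≤l (matching-≤ D? D-uniform (matching mN) mN⊑D)) D-uniform)
          (matching mN) mN⊑D

      -- `X₀` meets every edge between S and z by saturation, and every edge inside S by maximality,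
      -- so all that is left to dominate lies in `W`.
      K≡μ+ : ∀ {j} → EDS W j → μ + j ≡ K
      K≡μ+ {j} F = uniform (eds-matching (matching X₀-maximal) _ (eds-ext sub edges F))
        where
        sub : W ⊑ (Full ∖ X₀)
        sub v∉S = tt , v∉S ∘ inside X₀-maximal
        edges : ∀ {a b} → (Full ∖ X₀) a → (Full ∖ X₀) b → a ~ b → W a
        edges {a} {b} (_ , ¬a) (_ , ¬b) ab Sa with b ≟ z
        ... | yes refl = ¬a (S-saturates X₀-maximal Sa ab)
        ... | no b≢z = free X₀-maximal (Sa , ¬a) (cut Sa ab b≢z , ¬b) ab

      MaxM-D⇒MaxM-W : ∀ {N j} → MaxM D N j → MaxM W N j
      MaxM-D⇒MaxM-W {N} mN = maxM (matching mN) (proj₁ ∘ inside mN) fr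
        where
        fr : Indep (W ∖ N)
        fr {a} {b} (a∉S , ¬a) (b∉S , ¬b) ab with a ≟ z | b ≟ z
        ... | yes refl | yes refl = ~⇒≢ ab refl
        ... | yes refl | no b≢z = ¬b (D-saturates mN (b∉S , b≢z) (~-sym ab))
        ... | no a≢z | yes refl = ¬a (D-saturates mN (a∉S , a≢z) ab)
        ... | no a≢z | no b≢z = free mN ((a∉S , a≢z) , ¬a) ((b∉S , b≢z) , ¬b) ab

      K≡μ+ν : μ + ν ≡ K
      K≡μ+ν = K≡μ+ (eds-maximal (MaxM-D⇒MaxM-W N₀-maximal))

      W-uniform : Uniform W ν
      W-uniform F = +-cancelˡ-≡ μ _ _ (trans (K≡μ+ F) (≡-sym K≡μ+ν))

-- The structure of S around the edge x y

module Side {n : ℕ} (G : Graph n) where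

  open EdgeDomination G
  open Bipartition G
  open Cut G

  disjoint : ∀ {a b u v : V} → a ≢ u → a ≢ v → b ≢ u → b ≢ v → ¬ SharesEndpoint u v (a , b)
  disjoint p q r s (inj₁ e) = p e
  disjoint p q r s (inj₂ (inj₁ e)) = q e
  disjoint p q r s (inj₂ (inj₂ (inj₁ e))) = r e
  disjoint p q r s (inj₂ (inj₂ (inj₂ e))) = s e

  module _ {x y z : V} (s : Setup x y z) where

    open Setup s
    open Sides s

    -- A maximum matching of S with the edges x p and y q set aside, so that these four vertices can
    -- be paired anew while `rest` stays fixed.
    record Config (p q : V) (X : VSet) (i : ℕ) : Set where
      field
        x~p  : x ~ p
        y~q  : y ~ q
        Sp   : S p
        Sq   : S q
        p≢y  : p ≢ y
        q≢x  : q ≢ x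
        rest : Matching X i
        X⊑S  : X ⊑ S
        ¬Xx  : ¬ X x
        ¬Xy  : ¬ X y
        ¬Xp  : ¬ X p
        ¬Xq  : ¬ X q
        size : suc (suc i) ≡ μ

    abstract
      -- A maximal matching of S through x p has to saturate y, a neighbour of z; its partner there
      -- is q.
      config : ∀ {p} → S p → x ~ p → p ≢ y → ∃ λ q → ∃ λ X → ∃ λ i → Config p q X i
      config {p} Sp x~p p≢y with maximal (-‿dec (-‿dec S? x) p)
      ... | Y , j , mY = found (S-saturates mS Sy y~z)
        where
        mS : MaxM S (Adjoin Y x p) (suc j)
        mS = MaxM-adjoin x~p Sx Sp mY
        found : Adjoin Y x p y → ∃ λ q → ∃ λ X → ∃ λ i → Config p q X i
        found (inj₁ refl) = contradiction refl (~⇒≢ x~y)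
        found (inj₂ (inj₁ refl)) = contradiction refl p≢y
        found (inj₂ (inj₂ Yy)) with mate (matching mY) Yy
        ... | q , i , yq , Yq , refl , m with inside mY Yq
        ... | (Sq , q≢x) , q≢p = q , (Y - y - q) , i , record
          { x~p = x~p ; y~q = yq ; Sp = Sp ; Sq = Sq ; p≢y = p≢y ; q≢x = q≢x ; rest = m
          ; X⊑S = λ ((v , _) , _) → proj₁ (proj₁ (inside mY v))
          ; ¬Xx = λ ((v , _) , _) → proj₂ (proj₁ (inside mY v)) refl
          ; ¬Xy = λ ((_ , v) , _) → v refl
          ; ¬Xp = λ ((v , _) , _) → proj₂ (inside mY v) refl
          ; ¬Xq = λ (_ , v) → v refl
          ; size = S-uniform (eds-maximal mS) }

    module Configured {p q X i} (C : Config p q X i) where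

      open Config C

      p≢q : p ≢ q
      p≢q refl = tri x~y y~q x~p (≢-sym (~⇒≢ x~p)) p≢y (S⇒≢z Sp)

      private
        two-edges : ∀ {a b c d} → a ~ b → c ~ d → a ≢ c → a ≢ d → b ≢ c → b ≢ d
          → S a → S b → S c → S d → ¬ X a → ¬ X b → ¬ X c → ¬ X d
          → MaxM S (Adjoin (Adjoin X c d) a b) μ
        two-edges ab cd ac ad bc bd Sa Sb Sc Sd ¬a ¬b ¬c ¬d = full⇒maximal S? S-uniform
          (subst (Matching _) size (adjoin ab
            (λ { (inj₁ p) → ac p ; (inj₂ (inj₁ p)) → ad p ; (inj₂ (inj₂ v)) → ¬a v })
            (λ { (inj₁ p) → bc p ; (inj₂ (inj₁ p)) → bd p ; (inj₂ (inj₂ v)) → ¬b v })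
            (adjoin cd ¬c ¬d rest)))
          (λ { (inj₁ refl) → Sa ; (inj₂ (inj₁ refl)) → Sb ; (inj₂ (inj₂ (inj₁ refl))) → Sc
             ; (inj₂ (inj₂ (inj₂ (inj₁ refl)))) → Sd ; (inj₂ (inj₂ (inj₂ (inj₂ v)))) → X⊑S v })

        -- `rest` has μ - 2 edges, so two disjoint edges of S off it complete it to a maximal
        -- matching, and this must saturate w. It is applied with w = x or w = y.
        no-two-edges : ∀ {w a b c d} → S w → w ~ z → ¬ X w → w ≢ a → w ≢ b → w ≢ c → w ≢ d
          → a ~ b → c ~ d → a ≢ c → a ≢ d → b ≢ c → b ≢ d
          → S a → S b → S c → S d → ¬ X a → ¬ X b → ¬ X c → ¬ X d → ⊥
        no-two-edges Sw wz ¬w wa wb wc wd ab cd ac ad bc bd Sa Sb Sc Sd ¬a ¬b ¬c ¬d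
          with S-saturates (two-edges ab cd ac ad bc bd Sa Sb Sc Sd ¬a ¬b ¬c ¬d) Sw wz
        ... | inj₁ p = wa p
        ... | inj₂ (inj₁ p) = wb p
        ... | inj₂ (inj₂ (inj₁ p)) = wc p
        ... | inj₂ (inj₂ (inj₂ (inj₁ p))) = wd p
        ... | inj₂ (inj₂ (inj₂ (inj₂ v))) = ¬w v

      module _ {u} (Su : S u) (¬Xu : ¬ X u) (u≢x : u ≢ x) (u≢y : u ≢ y) (u≢p : u ≢ p) (u≢q : u ≢ q) where

        u≁p : ¬ u ~ p
        u≁p up = no-two-edges Sx x~z ¬Xx (≢-sym u≢x) (~⇒≢ x~p) (~⇒≢ x~y) (≢-sym q≢x)
          up y~q u≢y u≢q p≢y p≢q Su Sp Sy Sq ¬Xu ¬Xp ¬Xy ¬Xq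

        u≁q : ¬ u ~ q
        u≁q uq = no-two-edges Sy y~z ¬Xy (≢-sym u≢y) (~⇒≢ y~q) (≢-sym (~⇒≢ x~y)) (≢-sym p≢y)
          uq x~p u≢x u≢p q≢x (≢-sym p≢q) Su Sq Sx Sp ¬Xu ¬Xq ¬Xx ¬Xp

      maximum : MaxM S (Adjoin (Adjoin X y q) x p) μ
      maximum = two-edges x~p y~q (~⇒≢ x~y) (≢-sym q≢x) p≢y p≢q Sx Sp Sy Sq ¬Xx ¬Xp ¬Xy ¬Xq

      -- `rest` with x y is one edge short of μ, so it leaves an edge free. That edge meets p or q
      -- because `maximum` is maximal, and no outside vertex is adjacent to p or q.
      p~q : p ~ q
      p~q with augment S? S-uniform (adjoin x~y ¬Xx ¬Xy rest)
             (λ { (inj₁ refl) → Sx ; (inj₂ (inj₁ refl)) → Sy ; (inj₂ (inj₂ v)) → X⊑S v })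
             (λ e → 1+n≢n (trans size (≡-sym e)))
      ... | a , b , ab , (Sa , ¬a) , (Sb , ¬b) = cases (a ≟ p) (a ≟ q) (b ≟ p) (b ≟ q)
        where
        a≢x = ¬a ∘ inj₁
        a≢y = ¬a ∘ inj₂ ∘ inj₁
        ¬Xa = ¬a ∘ inj₂ ∘ inj₂
        b≢x = ¬b ∘ inj₁
        b≢y = ¬b ∘ inj₂ ∘ inj₁
        ¬Xb = ¬b ∘ inj₂ ∘ inj₂
        cases : Dec (a ≡ p) → Dec (a ≡ q) → Dec (b ≡ p) → Dec (b ≡ q) → p ~ q
        cases (yes refl) _ _ (yes refl) = ab
        cases (yes refl) _ _ (no b≢q) = ⊥-elim (u≁p Sb ¬Xb b≢x b≢y (≢-sym (~⇒≢ ab)) b≢q (~-sym ab))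
        cases (no _) (yes refl) (yes refl) _ = ~-sym ab
        cases (no _) (yes refl) (no b≢p) _ =
          ⊥-elim (u≁q Sb ¬Xb b≢x b≢y b≢p (≢-sym (~⇒≢ ab)) (~-sym ab))
        cases (no a≢p) (no a≢q) (yes refl) _ = ⊥-elim (u≁p Sa ¬Xa a≢x a≢y a≢p a≢q ab)
        cases (no a≢p) (no a≢q) (no _) (yes refl) = ⊥-elim (u≁q Sa ¬Xa a≢x a≢y a≢p a≢q ab)
        cases (no a≢p) (no a≢q) (no b≢p) (no b≢q) = ⊥-elim (free maximum
          (Sa , λ { (inj₁ p) → a≢x p ; (inj₂ (inj₁ p)) → a≢p p ; (inj₂ (inj₂ (inj₁ p))) → a≢y p
                  ; (inj₂ (inj₂ (inj₂ (inj₁ p)))) → a≢q p ; (inj₂ (inj₂ (inj₂ (inj₂ v)))) → ¬Xa v })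
          (Sb , λ { (inj₁ p) → b≢x p ; (inj₂ (inj₁ p)) → b≢p p ; (inj₂ (inj₂ (inj₁ p))) → b≢y p
                  ; (inj₂ (inj₂ (inj₂ (inj₁ p)))) → b≢q p ; (inj₂ (inj₂ (inj₂ (inj₂ v)))) → ¬Xb v })
          ab)

      module _ {u} (Su : S u) (¬Xu : ¬ X u) (u≢x : u ≢ x) (u≢y : u ≢ y) (u≢p : u ≢ p) (u≢q : u ≢ q) where

        u≁x : ¬ u ~ x
        u≁x ux = no-two-edges Sy y~z ¬Xy (≢-sym u≢y) (≢-sym (~⇒≢ x~y)) (≢-sym p≢y) (~⇒≢ y~q)
          ux p~q u≢p u≢q (~⇒≢ x~p) (≢-sym q≢x) Su Sx Sp Sq ¬Xu ¬Xx ¬Xp ¬Xq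

        u≁y : ¬ u ~ y
        u≁y uy = no-two-edges Sx x~z ¬Xx (≢-sym u≢x) (~⇒≢ x~y) (~⇒≢ x~p) (≢-sym q≢x)
          uy p~q u≢p u≢q (≢-sym p≢y) (~⇒≢ y~q) Su Sy Sp Sq ¬Xu ¬Xy ¬Xp ¬Xq

    -- A third neighbour r of x in S completes x, y, p, q to a K₃,₃ together with a neighbour t
    -- of y, and then the edges z y, x p, q p, t p form a larger minimal edge dominating set than
    -- the matching x r, p q, y t.
    module ThirdNeighbour {p q X₁ i₁ r} (C : Config p q X₁ i₁) (Sr : S r) (x~r : x ~ r)
      (r≢y : r ≢ y) (r≢p : r ≢ p) where

      open Config C using (x~p; y~q; Sp; Sq; p≢y; q≢x)
      open Configured C using (p≢q; p~q)

      r≢q : r ≢ q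
      r≢q refl = tri x~y y~q x~r q≢x (≢-sym (~⇒≢ y~q)) (S⇒≢z Sq)

      module Completed {Y j t} (mY : MaxM (S - x - r - p - q) Y (suc j))
        (y~t : y ~ t) (Yt : Y t) (Yy : Y y) (m : Matching (Y - y - t) j) where

        X : VSet
        X = Y - y - t

        X⊑ : X ⊑ (S - x - r - p - q)
        X⊑ ((v , _) , _) = inside mY v

        X⊑S : X ⊑ S
        X⊑S v = proj₁ (proj₁ (proj₁ (proj₁ (X⊑ v))))
        ¬Xx : ¬ X x
        ¬Xx v = proj₂ (proj₁ (proj₁ (proj₁ (X⊑ v)))) refl
        ¬Xr : ¬ X r
        ¬Xr v = proj₂ (proj₁ (proj₁ (X⊑ v))) refl
        ¬Xp : ¬ X p
        ¬Xp v = proj₂ (proj₁ (X⊑ v)) refl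
        ¬Xq : ¬ X q
        ¬Xq v = proj₂ (X⊑ v) refl
        ¬Xy : ¬ X y
        ¬Xy ((_ , v) , _) = v refl
        ¬Xt : ¬ X t
        ¬Xt (_ , v) = v refl

        St : S t
        St = proj₁ (proj₁ (proj₁ (proj₁ (inside mY Yt))))
        t≢x : t ≢ x
        t≢x = proj₂ (proj₁ (proj₁ (proj₁ (inside mY Yt))))
        t≢r : t ≢ r
        t≢r = proj₂ (proj₁ (proj₁ (inside mY Yt)))
        t≢p : t ≢ p
        t≢p = proj₂ (proj₁ (inside mY Yt))
        t≢q : t ≢ q
        t≢q = proj₂ (inside mY Yt)

        mS : MaxM S (Adjoin (Adjoin Y p q) x r) (suc (suc (suc j)))
        mS = MaxM-adjoin x~r Sx Sr (MaxM-adjoin p~q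
          ((Sp , ≢-sym (~⇒≢ x~p)) , ≢-sym r≢p) ((Sq , q≢x) , ≢-sym r≢q) mY)

        size : suc (suc (suc j)) ≡ μ
        size = S-uniform (eds-maximal mS)

        -- Any edge a b off X that avoids x, y, r, t may join X in the rest: only the size of the
        -- rest matters. Varying a b makes the facts about one configuration available for many.
        config-rt : ∀ {a b} → a ~ b → S a → S b → ¬ X a → ¬ X b → a ≢ x → a ≢ y → a ≢ r → a ≢ t
                  → b ≢ x → b ≢ y → b ≢ r → b ≢ t → Config r t (Adjoin X a b) (suc j)
        config-rt ab Sa Sb ¬a ¬b ax ay ar at bx by br bt = record
          { x~p = x~r ; y~q = y~t ; Sp = Sr ; Sq = St ; p≢y = r≢y ; q≢x = t≢x
          ; rest = adjoin ab ¬a ¬b m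
          ; X⊑S = λ { (inj₁ refl) → Sa ; (inj₂ (inj₁ refl)) → Sb ; (inj₂ (inj₂ v)) → X⊑S v }
          ; ¬Xx = λ { (inj₁ p) → ax (≡-sym p) ; (inj₂ (inj₁ p)) → bx (≡-sym p) ; (inj₂ (inj₂ v)) → ¬Xx v }
          ; ¬Xy = λ { (inj₁ p) → ay (≡-sym p) ; (inj₂ (inj₁ p)) → by (≡-sym p) ; (inj₂ (inj₂ v)) → ¬Xy v }
          ; ¬Xp = λ { (inj₁ p) → ar (≡-sym p) ; (inj₂ (inj₁ p)) → br (≡-sym p) ; (inj₂ (inj₂ v)) → ¬Xr v }
          ; ¬Xq = λ { (inj₁ p) → at (≡-sym p) ; (inj₂ (inj₁ p)) → bt (≡-sym p) ; (inj₂ (inj₂ v)) → ¬Xt v }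
          ; size = size }

        p≢x : p ≢ x
        p≢x = ≢-sym (~⇒≢ x~p)
        q≢y : q ≢ y
        q≢y = ≢-sym (~⇒≢ y~q)
        t≢y : t ≢ y
        t≢y = ≢-sym (~⇒≢ y~t)

        C-rt : Config r t (Adjoin X p q) (suc j)
        C-rt = config-rt p~q Sp Sq ¬Xp ¬Xq p≢x p≢y (≢-sym r≢p) (≢-sym t≢p)
          q≢x q≢y (≢-sym r≢q) (≢-sym t≢q)

        r~t : r ~ t
        r~t = Configured.p~q C-rt

        Core : V → Set
        Core v = v ≡ x ⊎ v ≡ y ⊎ v ≡ p ⊎ v ≡ q ⊎ v ≡ r ⊎ v ≡ t

        core? : ∀ v → Dec (Core v)
        core? v = (v ≟ x) ⊎-dec (v ≟ y) ⊎-dec (v ≟ p) ⊎-dec (v ≟ q) ⊎-dec (v ≟ r) ⊎-dec (v ≟ t)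

        module _ {u} (Su : S u) (¬Xu : ¬ X u) (¬core : ¬ Core u) where

          private
            u≢x : u ≢ x
            u≢x = ¬core ∘ inj₁
            u≢y : u ≢ y
            u≢y = ¬core ∘ inj₂ ∘ inj₁
            u≢p : u ≢ p
            u≢p = ¬core ∘ inj₂ ∘ inj₂ ∘ inj₁
            u≢q : u ≢ q
            u≢q = ¬core ∘ inj₂ ∘ inj₂ ∘ inj₂ ∘ inj₁
            u≢r : u ≢ r
            u≢r = ¬core ∘ inj₂ ∘ inj₂ ∘ inj₂ ∘ inj₂ ∘ inj₁
            u≢t : u ≢ t
            u≢t = ¬core ∘ inj₂ ∘ inj₂ ∘ inj₂ ∘ inj₂ ∘ inj₂
            ¬Au : ¬ Adjoin X p q u
            ¬Au (inj₁ e) = u≢p e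
            ¬Au (inj₂ (inj₁ e)) = u≢q e
            ¬Au (inj₂ (inj₂ v)) = ¬Xu v

          u≁core : ∀ {v} → Core v → ¬ u ~ v
          u≁core (inj₁ refl) = Configured.u≁x C-rt Su ¬Au u≢x u≢y u≢r u≢t
          u≁core (inj₂ (inj₁ refl)) = Configured.u≁y C-rt Su ¬Au u≢x u≢y u≢r u≢t
          -- With u p in the rest instead of p q, the vertex q lies outside the configuration, so it
          -- could not be adjacent to y.
          u≁core (inj₂ (inj₂ (inj₁ refl))) up = Configured.u≁y
            (config-rt up Su Sp ¬Xu ¬Xp u≢x u≢y u≢r u≢t p≢x p≢y (≢-sym r≢p) (≢-sym t≢p))
            Sq (λ { (inj₁ e) → u≢q (≡-sym e) ; (inj₂ (inj₁ e)) → p≢q (≡-sym e) ; (inj₂ (inj₂ v)) → ¬Xq v })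
            q≢x q≢y (≢-sym r≢q) (≢-sym t≢q) (~-sym y~q)
          u≁core (inj₂ (inj₂ (inj₂ (inj₁ refl)))) uq = Configured.u≁x
            (config-rt uq Su Sq ¬Xu ¬Xq u≢x u≢y u≢r u≢t q≢x q≢y (≢-sym r≢q) (≢-sym t≢q))
            Sp (λ { (inj₁ e) → u≢p (≡-sym e) ; (inj₂ (inj₁ e)) → p≢q e ; (inj₂ (inj₂ v)) → ¬Xp v })
            p≢x p≢y (≢-sym r≢p) (≢-sym t≢p) (~-sym x~p)
          u≁core (inj₂ (inj₂ (inj₂ (inj₂ (inj₁ refl))))) = Configured.u≁p C-rt Su ¬Au u≢x u≢y u≢r u≢t
          u≁core (inj₂ (inj₂ (inj₂ (inj₂ (inj₂ refl))))) = Configured.u≁q C-rt Su ¬Au u≢x u≢y u≢r u≢t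

        core-indep : Indep ((S ∖ X) ∖ Core)
        core-indep ((Sa , ¬a) , a∉) ((Sb , ¬b) , b∉) = free mS (out Sa ¬a a∉) (out Sb ¬b b∉)
          where
          out : ∀ {v} → S v → ¬ X v → ¬ Core v → (S ∖ Adjoin (Adjoin Y p q) x r) v
          out {v} Sv ¬v v∉ = Sv ,
            λ { (inj₁ e) → v∉ (inj₁ e) ; (inj₂ (inj₁ e)) → v∉ (inj₂ (inj₂ (inj₂ (inj₂ (inj₁ e)))))
              ; (inj₂ (inj₂ (inj₁ e))) → v∉ (inj₂ (inj₂ (inj₁ e)))
              ; (inj₂ (inj₂ (inj₂ (inj₁ e)))) → v∉ (inj₂ (inj₂ (inj₂ (inj₁ e))))
              ; (inj₂ (inj₂ (inj₂ (inj₂ Yv)))) → ¬v ((Yv , v∉ ∘ inj₂ ∘ inj₁)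
                                                     , v∉ ∘ inj₂ ∘ inj₂ ∘ inj₂ ∘ inj₂ ∘ inj₂) }

        -- Two disjoint edges on x, y, p, q, r, t extend X to a matching of size μ − 1, which
        -- therefore leaves an edge on the other two vertices.
        leftover : ∀ {a b c d} → a ~ b → c ~ d → a ≢ c → a ≢ d → b ≢ c → b ≢ d
          → S a → S b → S c → S d → ¬ X a → ¬ X b → ¬ X c → ¬ X d
          → ∃ λ e → ∃ λ f → e ~ f × Core e × Core f
            × ¬ Adjoin (Adjoin X c d) a b e × ¬ Adjoin (Adjoin X c d) a b f
        leftover ab cd ac ad bc bd Sa Sb Sc Sd ¬a ¬b ¬c ¬d
          with augment S? S-uniform
            (adjoin ab
              (λ { (inj₁ p) → ac p ; (inj₂ (inj₁ p)) → ad p ; (inj₂ (inj₂ v)) → ¬a v })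
              (λ { (inj₁ p) → bc p ; (inj₂ (inj₁ p)) → bd p ; (inj₂ (inj₂ v)) → ¬b v })
              (adjoin cd ¬c ¬d m))
            (λ { (inj₁ refl) → Sa ; (inj₂ (inj₁ refl)) → Sb ; (inj₂ (inj₂ (inj₁ refl))) → Sc
               ; (inj₂ (inj₂ (inj₂ (inj₁ refl)))) → Sd ; (inj₂ (inj₂ (inj₂ (inj₂ v)))) → X⊑S v })
            (λ e → 1+n≢n (trans size (≡-sym e)))
        ... | e , f , ef , (Se , ¬e) , (Sf , ¬f) with core? e | core? f
        ... | yes ce | yes cf = e , f , ef , ce , cf , ¬e , ¬f
        ... | yes ce | no f∉ =
          ⊥-elim (u≁core Sf (¬f ∘ inj₂ ∘ inj₂ ∘ inj₂ ∘ inj₂) f∉ ce (~-sym ef))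
        ... | no e∉ | yes cf = ⊥-elim (u≁core Se (¬e ∘ inj₂ ∘ inj₂ ∘ inj₂ ∘ inj₂) e∉ cf ef)
        ... | no e∉ | no f∉ = ⊥-elim (core-indep ((Se , ¬e ∘ inj₂ ∘ inj₂ ∘ inj₂ ∘ inj₂) , e∉)
                                                 ((Sf , ¬f ∘ inj₂ ∘ inj₂ ∘ inj₂ ∘ inj₂) , f∉) ef)

        private
          pattern is-x = inj₁ refl
          pattern is-y = inj₂ (inj₁ refl)
          pattern is-p = inj₂ (inj₂ (inj₁ refl))
          pattern is-q = inj₂ (inj₂ (inj₂ (inj₁ refl)))
          pattern is-r = inj₂ (inj₂ (inj₂ (inj₂ (inj₁ refl))))
          pattern is-t = inj₂ (inj₂ (inj₂ (inj₂ (inj₂ refl))))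

        q~r : q ~ r
        q~r with leftover x~p y~t (~⇒≢ x~y) (≢-sym t≢x) p≢y (≢-sym t≢p) Sx Sp Sy St ¬Xx ¬Xp ¬Xy ¬Xt
        ... | e , f , ef , ce , cf , ¬e , ¬f = pick ce cf ef (¬e , ¬f)
          where
          Out : V → Set
          Out = Adjoin (Adjoin X y t) x p
          only : ∀ {v} → Core v → ¬ Out v → v ≡ q ⊎ v ≡ r
          only is-x o = contradiction (inj₁ refl) o
          only is-y o = contradiction (inj₂ (inj₂ (inj₁ refl))) o
          only is-p o = contradiction (inj₂ (inj₁ refl)) o
          only is-q o = inj₁ refl
          only is-r o = inj₂ refl
          only is-t o = contradiction (inj₂ (inj₂ (inj₂ (inj₁ refl)))) o
          pick : ∀ {e f} → Core e → Core f → e ~ f → ¬ Out e × ¬ Out f → q ~ r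
          pick ce cf ef (¬e , ¬f) with only ce ¬e | only cf ¬f
          ... | inj₁ refl | inj₁ refl = contradiction refl (~⇒≢ ef)
          ... | inj₁ refl | inj₂ refl = ef
          ... | inj₂ refl | inj₁ refl = ~-sym ef
          ... | inj₂ refl | inj₂ refl = contradiction refl (~⇒≢ ef)

        t~p : t ~ p
        t~p with leftover x~r y~q (~⇒≢ x~y) (≢-sym q≢x) r≢y r≢q Sx Sr Sy Sq ¬Xx ¬Xr ¬Xy ¬Xq
        ... | e , f , ef , ce , cf , ¬e , ¬f = pick ce cf ef (¬e , ¬f)
          where
          Out : V → Set
          Out = Adjoin (Adjoin X y q) x r
          only : ∀ {v} → Core v → ¬ Out v → v ≡ t ⊎ v ≡ p
          only is-x o = contradiction (inj₁ refl) o
          only is-y o = contradiction (inj₂ (inj₂ (inj₁ refl))) o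
          only is-p o = inj₂ refl
          only is-q o = contradiction (inj₂ (inj₂ (inj₂ (inj₁ refl)))) o
          only is-r o = contradiction (inj₂ (inj₁ refl)) o
          only is-t o = inj₁ refl
          pick : ∀ {e f} → Core e → Core f → e ~ f → ¬ Out e × ¬ Out f → t ~ p
          pick ce cf ef (¬e , ¬f) with only ce ¬e | only cf ¬f
          ... | inj₁ refl | inj₁ refl = contradiction refl (~⇒≢ ef)
          ... | inj₁ refl | inj₂ refl = ef
          ... | inj₂ refl | inj₁ refl = ~-sym ef
          ... | inj₂ refl | inj₂ refl = contradiction refl (~⇒≢ ef)

        XN R : VSet
        XN = X ∪ N₀
        R = Full ∖ XN

        S⇒R : ∀ {v} → S v → ¬ X v → R v
        S⇒R Sv ¬v = tt , λ { (inj₁ a) → ¬v a ; (inj₂ b) → proj₁ (inside N₀-maximal b) Sv }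

        Rz : R z
        Rz = tt , λ { (inj₁ a) → ¬Sz (X⊑S a) ; (inj₂ b) → proj₂ (inside N₀-maximal b) refl }

        -- Saturation in S and in D rules out edges from z to free vertices other than those of the
        -- core; maximality and `u≁core` rule out the remaining edges.
        R-edge : ∀ {u v} → R u → R v → u ~ v → u ≡ z ⊎ Core u
        R-edge {u} {v} (_ , ¬u) (_ , ¬v) uv with u ≟ z | S? u | v ≟ z | S? v
        ... | yes e | _ | _ | _ = inj₁ e
        ... | no u≢z | no u∉S | yes refl | _ =
          ⊥-elim (¬u (inj₂ (D-saturates N₀-maximal (u∉S , u≢z) uv)))
        ... | no u≢z | no u∉S | no _ | yes Sv = ⊥-elim (S≁D Sv (u∉S , u≢z) (~-sym uv))
        ... | no u≢z | no u∉S | no v≢z | no v∉S =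
          ⊥-elim (free N₀-maximal ((u∉S , u≢z) , ¬u ∘ inj₂) ((v∉S , v≢z) , ¬v ∘ inj₂) uv)
        ... | no u≢z | yes Su | v=z? | v=S? with core? u
        ... | yes cu = inj₂ cu
        ... | no u∉ = ⊥-elim (loose v=z? v=S?)
          where
          loose : Dec (v ≡ z) → Dec (S v) → ⊥
          loose (yes refl) _ with S-saturates mS Su uv
          ... | inj₁ e = u∉ (inj₁ e)
          ... | inj₂ (inj₁ e) = u∉ (inj₂ (inj₂ (inj₂ (inj₂ (inj₁ e)))))
          ... | inj₂ (inj₂ (inj₁ e)) = u∉ (inj₂ (inj₂ (inj₁ e)))
          ... | inj₂ (inj₂ (inj₂ (inj₁ e))) = u∉ (inj₂ (inj₂ (inj₂ (inj₁ e))))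
          ... | inj₂ (inj₂ (inj₂ (inj₂ Yu))) =
            ¬u (inj₁ ((Yu , u∉ ∘ inj₂ ∘ inj₁) , u∉ ∘ inj₂ ∘ inj₂ ∘ inj₂ ∘ inj₂ ∘ inj₂))
          loose (no v≢z) (no v∉S) = S≁D Su (v∉S , v≢z) uv
          loose (no v≢z) (yes Sv) with core? v
          ... | yes cv = u≁core Su (¬u ∘ inj₁) u∉ cv uv
          ... | no v∉ = core-indep ((Su , ¬u ∘ inj₁) , u∉) ((Sv , ¬v ∘ inj₁) , v∉) uv

        -- The parts of the K₃,₃ are {x, q, t} and {y, p, r}. The star at p covers the first part
        -- and z y covers z and y. Only r stays uncovered, so x r, q r and t r are private to the
        -- three edges of the star.
        four-edges : EDS R 4
        four-edges = eds edge valid dom priv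
          where
          edge : Fin 4 → V × V
          edge zero = z , y
          edge (suc zero) = x , p
          edge (suc (suc zero)) = q , p
          edge (suc (suc (suc zero))) = t , p
          valid : ∀ i → R (proj₁ (edge i)) × R (proj₂ (edge i)) × proj₁ (edge i) ~ proj₂ (edge i)
          valid zero = Rz , S⇒R Sy ¬Xy , ~-sym y~z
          valid (suc zero) = S⇒R Sx ¬Xx , S⇒R Sp ¬Xp , x~p
          valid (suc (suc zero)) = S⇒R Sq ¬Xq , S⇒R Sp ¬Xp , ~-sym p~q
          valid (suc (suc (suc zero))) = S⇒R St ¬Xt , S⇒R Sp ¬Xp , t~p
          covered : ∀ {u} → u ≡ z ⊎ Core u → u ≢ r
                  → ∃ λ i → proj₁ (edge i) ≡ u ⊎ proj₂ (edge i) ≡ u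
          covered (inj₁ refl) _ = zero , inj₁ refl
          covered (inj₂ is-x) _ = suc zero , inj₁ refl
          covered (inj₂ is-y) _ = zero , inj₂ refl
          covered (inj₂ is-p) _ = suc zero , inj₂ refl
          covered (inj₂ is-q) _ = suc (suc zero) , inj₁ refl
          covered (inj₂ is-r) u≢r = contradiction refl u≢r
          covered (inj₂ is-t) _ = suc (suc (suc zero)) , inj₁ refl
          dom : ∀ {u v} → R u → R v → u ~ v → ∃ λ i → SharesEndpoint u v (edge i)
          dom {u} {v} Ru Rv uv with u ≟ r
          ... | no u≢r with covered (R-edge Ru Rv uv) u≢r
          ...   | i , inj₁ e = i , inj₁ e
          ...   | i , inj₂ e = i , inj₂ (inj₂ (inj₁ e))
          dom Ru Rv uv | yes refl with covered (R-edge Rv Ru (~-sym uv)) (≢-sym (~⇒≢ uv))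
          ...   | i , inj₁ e = i , inj₂ (inj₁ e)
          ...   | i , inj₂ e = i , inj₂ (inj₂ (inj₂ e))
          z≢ : ∀ {v} → S v → z ≢ v
          z≢ Sv = ≢-sym (S⇒≢z Sv)
          priv : ∀ i → ∃ λ u → ∃ λ v → R u × R v × u ~ v
               × (∀ j → SharesEndpoint u v (edge j) → j ≡ i)
          priv zero = z , y , Rz , S⇒R Sy ¬Xy , ~-sym y~z , λ
            { zero _ → refl
            ; (suc zero) e → ⊥-elim (disjoint (S⇒≢z Sx) (~⇒≢ x~y) (S⇒≢z Sp) p≢y e)
            ; (suc (suc zero)) e → ⊥-elim (disjoint (S⇒≢z Sq) q≢y (S⇒≢z Sp) p≢y e)
            ; (suc (suc (suc zero))) e → ⊥-elim (disjoint (S⇒≢z St) t≢y (S⇒≢z Sp) p≢y e) }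
          priv (suc zero) = x , r , S⇒R Sx ¬Xx , S⇒R Sr ¬Xr , x~r , λ
            { zero e → ⊥-elim (disjoint (z≢ Sx) (z≢ Sr) (≢-sym (~⇒≢ x~y)) (≢-sym r≢y) e)
            ; (suc zero) _ → refl
            ; (suc (suc zero)) e → ⊥-elim (disjoint q≢x (≢-sym r≢q) p≢x (≢-sym r≢p) e)
            ; (suc (suc (suc zero))) e → ⊥-elim (disjoint t≢x t≢r p≢x (≢-sym r≢p) e) }
          priv (suc (suc zero)) = q , r , S⇒R Sq ¬Xq , S⇒R Sr ¬Xr , q~r , λ
            { zero e → ⊥-elim (disjoint (z≢ Sq) (z≢ Sr) (≢-sym q≢y) (≢-sym r≢y) e)
            ; (suc zero) e → ⊥-elim (disjoint (≢-sym q≢x) (~⇒≢ x~r) p≢q (≢-sym r≢p) e)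
            ; (suc (suc zero)) _ → refl
            ; (suc (suc (suc zero))) e → ⊥-elim (disjoint t≢q t≢r p≢q (≢-sym r≢p) e) }
          priv (suc (suc (suc zero))) = t , r , S⇒R St ¬Xt , S⇒R Sr ¬Xr , ~-sym r~t , λ
            { zero e → ⊥-elim (disjoint (z≢ St) (z≢ Sr) (≢-sym t≢y) (≢-sym r≢y) e)
            ; (suc zero) e → ⊥-elim (disjoint (≢-sym t≢x) (~⇒≢ x~r) (≢-sym t≢p) (≢-sym r≢p) e)
            ; (suc (suc zero)) e → ⊥-elim (disjoint (≢-sym t≢q) (≢-sym r≢q) (≢-sym t≢p) (≢-sym r≢p) e)
            ; (suc (suc (suc zero))) _ → refl }

        abstract
          impossible : ⊥
          -- X and `N₀` contribute j + ν edges and R contributes four, whereas K = μ + ν = j + 3 +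
          -- ν.
          impossible = 1+n≢n {3} (+-cancelˡ-≡ (j + ν) _ _ (trans
            (uniform (eds-matching (union m (matching N₀-maximal)
              (λ a b → proj₁ (inside N₀-maximal b) (X⊑S a))) _ four-edges))
            (trans (≡-sym K≡μ+ν) (trans (cong (_+ ν) (≡-sym size)) (trans (+-comm (3 + j) ν) rearrange)))))
            where
            rearrange : ν + (3 + j) ≡ (j + ν) + 3
            rearrange = trans (cong (ν +_) (+-comm 3 j)) (trans (≡-sym (+-assoc ν j 3)) (cong (_+ 3) (+-comm ν j)))

      abstract
        impossible : ⊥
        impossible with maximal (-‿dec (-‿dec (-‿dec (-‿dec S? x) r) p) q)
        ... | Y , k , mY = go (S-saturates mS Sy y~z)
          where
          mS : MaxM S (Adjoin (Adjoin Y p q) x r) (suc (suc k))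
          mS = MaxM-adjoin x~r Sx Sr (MaxM-adjoin p~q
            ((Sp , ≢-sym (~⇒≢ x~p)) , ≢-sym r≢p) ((Sq , q≢x) , ≢-sym r≢q) mY)
          go : Adjoin (Adjoin Y p q) x r y → ⊥
          go (inj₁ e) = ~⇒≢ x~y (≡-sym e)
          go (inj₂ (inj₁ e)) = r≢y (≡-sym e)
          go (inj₂ (inj₂ (inj₁ e))) = p≢y (≡-sym e)
          go (inj₂ (inj₂ (inj₂ (inj₁ e)))) = ~⇒≢ y~q e
          go (inj₂ (inj₂ (inj₂ (inj₂ Yy)))) with mate (matching mY) Yy
          ... | t , j , yt , Yt , refl , m = Completed.impossible mY yt Yt Yy m

-- S is an edge or a 4-cycle, and leaves in the second case

module Shape {n : ℕ} (G : Graph n) where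

  open EdgeDomination G
  open Bipartition G
  open Cut G
  open Side G
  open Minimisation G

  swap-config : ∀ {x y z p q X i} (s : Setup x y z) → Config s p q X i → Config (swap s) q p X i
  swap-config s C = record
    { x~p = y~q ; y~q = x~p ; Sp = Sq ; Sq = Sp ; p≢y = q≢x ; q≢x = p≢y ; rest = rest
    ; X⊑S = X⊑S ; ¬Xx = ¬Xy ; ¬Xy = ¬Xx ; ¬Xp = ¬Xq ; ¬Xq = ¬Xp ; size = size }
    where open Config C

  -- A maximal matching through p b and y q still has to saturate x. Its partner there is neither p
  -- nor y, hence a third neighbour of x.
  no-outer-nbr : ∀ {x y z p q X i b} (s : Setup x y z) → Config s p q X i
    → Setup.S s b → p ~ b → b ≢ x → b ≢ q → ⊥
  no-outer-nbr {x} {y} {z} {p} {q} {b = b} s C Sb p~b b≢x b≢q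
    with maximal (-‿dec (-‿dec (-‿dec (-‿dec (Setup.S? s) p) b) y) q)
  ... | Y , k , mY = go (S-saturates mS Sx x~z)
    where
    open Setup s
    open Sides s
    open Config C
    b≢y : b ≢ y
    b≢y refl = tri x~y (~-sym p~b) x~p (≢-sym (~⇒≢ x~p)) p≢y (S⇒≢z Sp)
    mS : MaxM S (Adjoin (Adjoin Y y q) p b) (suc (suc k))
    mS = MaxM-adjoin p~b Sp Sb (MaxM-adjoin y~q
      ((Sy , ≢-sym p≢y) , ≢-sym b≢y) ((Sq , ≢-sym (Configured.p≢q s C)) , ≢-sym b≢q) mY)
    go : Adjoin (Adjoin Y y q) p b x → ⊥
    go (inj₁ e) = ~⇒≢ x~p e
    go (inj₂ (inj₁ e)) = b≢x (≡-sym e)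
    go (inj₂ (inj₂ (inj₁ e))) = ~⇒≢ x~y e
    go (inj₂ (inj₂ (inj₂ (inj₁ e)))) = q≢x (≡-sym e)
    go (inj₂ (inj₂ (inj₂ (inj₂ Yx)))) with mate (matching mY) Yx
    ... | w , _ , xw , Yw , _ with inside mY Yw
    ... | (((Sw , w≢p) , _) , w≢y) , _ = ThirdNeighbour.impossible s C Sw xw w≢y w≢p

  record House {x y z} (s : Setup x y z) (p q : V) : Set where
    open Setup s
    field
      x~p  : x ~ p
      y~q  : y ~ q
      p~q  : p ~ q
      Sp   : S p
      Sq   : S q
      p≢y  : p ≢ y
      q≢x  : q ≢ x
      p≢q  : p ≢ q
      only : ∀ {v} → S v → v ≡ x ⊎ v ≡ y ⊎ v ≡ p ⊎ v ≡ q

  private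
    invariant : ∀ {P Q : VSet} {u v} → (∀ {a b} → Q a → a ~ b → P b → Q b) → Reach P u v → Q u → Q v
    invariant pres (here _) Qu = Qu
    invariant pres (step _ e r) Qu = invariant pres r (pres Qu e (reach-start r))

  module _ {x y z} (s : Setup x y z) where

    open Setup s
    open Sides s

    private
      triangle-only : ¬ (∃ λ v → S v × x ~ v × v ≢ y) → ¬ (∃ λ v → S v × y ~ v × v ≢ x)
                    → ∀ {v} → S v → v ≡ x ⊎ v ≡ y
      triangle-only ¬p ¬q Sv = invariant pres (conn Sv) (inj₁ refl)
        where
        pres : ∀ {a b} → a ≡ x ⊎ a ≡ y → a ~ b → b ≢ z → b ≡ x ⊎ b ≡ y
        pres {b = b} (inj₁ refl) ab b≢z with b ≟ y
        ... | yes b≡y = inj₂ b≡y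
        ... | no b≢y = contradiction (b , cut Sx ab b≢z , ab , b≢y) ¬p
        pres {b = b} (inj₂ refl) ab b≢z with b ≟ x
        ... | yes b≡x = inj₁ b≡x
        ... | no b≢x = contradiction (b , cut Sy ab b≢z , ab , b≢x) ¬q

      house : ∀ {p q X i} → Config s p q X i → House s p q
      house {p} {q} {X} {i} C = record
        { x~p = x~p ; y~q = y~q ; p~q = Configured.p~q s C ; Sp = Sp ; Sq = Sq ; p≢y = p≢y ; q≢x = q≢x
        ; p≢q = Configured.p≢q s C ; only = λ Sv → invariant pres (conn Sv) (inj₁ refl) }
        where
        open Config C
        C′ : Config (swap s) q p X i
        C′ = swap-config s C
        leave : ∀ {a b} → a ≡ x ⊎ a ≡ y ⊎ a ≡ p ⊎ a ≡ q → a ~ b → b ≢ z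
              → b ≢ x → b ≢ y → b ≢ p → b ≢ q → ⊥
        leave (inj₁ refl) ab b≢z b≢x b≢y b≢p b≢q =
          ThirdNeighbour.impossible s C (cut Sx ab b≢z) ab b≢y b≢p
        leave (inj₂ (inj₁ refl)) ab b≢z b≢x b≢y b≢p b≢q =
          ThirdNeighbour.impossible (swap s) C′ (cut Sy ab b≢z) ab b≢x b≢q
        leave (inj₂ (inj₂ (inj₁ refl))) ab b≢z b≢x b≢y b≢p b≢q =
          no-outer-nbr s C (cut Sp ab b≢z) ab b≢x b≢q
        leave (inj₂ (inj₂ (inj₂ refl))) ab b≢z b≢x b≢y b≢p b≢q =
          no-outer-nbr (swap s) C′ (cut Sq ab b≢z) ab b≢y b≢p
        pres : ∀ {a b} → a ≡ x ⊎ a ≡ y ⊎ a ≡ p ⊎ a ≡ q → a ~ b → b ≢ z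
             → b ≡ x ⊎ b ≡ y ⊎ b ≡ p ⊎ b ≡ q
        pres {a} {b} a∈ ab b≢z with b ≟ x | b ≟ y | b ≟ p | b ≟ q
        ... | yes e | _ | _ | _ = inj₁ e
        ... | _ | yes e | _ | _ = inj₂ (inj₁ e)
        ... | _ | _ | yes e | _ = inj₂ (inj₂ (inj₁ e))
        ... | _ | _ | _ | yes e = inj₂ (inj₂ (inj₂ e))
        ... | no b≢x | no b≢y | no b≢p | no b≢q = ⊥-elim (leave a∈ ab b≢z b≢x b≢y b≢p b≢q)

    shape : (∀ {v} → S v → v ≡ x ⊎ v ≡ y) ⊎ ∃ λ p → ∃ λ q → House s p q
    shape = cases (any? (λ v → S? v ×-dec (x ~? v) ×-dec ¬? (v ≟ y)))
                  (any? (λ v → S? v ×-dec (y ~? v) ×-dec ¬? (v ≟ x)))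
      where
      cases : Dec (∃ λ v → S v × x ~ v × v ≢ y) → Dec (∃ λ v → S v × y ~ v × v ≢ x)
            → (∀ {v} → S v → v ≡ x ⊎ v ≡ y) ⊎ ∃ λ p → ∃ λ q → House s p q
      cases (yes (p , Sp , xp , p≢y)) _ with config s Sp xp p≢y
      ... | q , _ , _ , C = inj₂ (p , q , house C)
      cases (no ¬p) (yes (q , Sq , yq , q≢x)) with config (swap s) Sq yq q≢x
      -- In the swapped configuration the roles of x and y are exchanged, so these fields describe a
      -- neighbour of x other than y.
      ... | p , _ , _ , C = contradiction (p , Config.Sq C , Config.y~q C , Config.q≢x C) ¬p
      cases (no ¬p) (no ¬q) = inj₁ (triangle-only ¬p ¬q)

  module HouseProperties {x y z p q} (s : Setup x y z) (H : House s p q) where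

    open Setup s
    open Sides s
    open House H

    μ≡2 : 2 ≡ μ
    μ≡2 = S-uniform (eds-maximal (MaxM-adjoin x~p Sx Sp (MaxM-adjoin y~q
      ((Sy , ≢-sym (~⇒≢ x~y)) , ≢-sym p≢y) ((Sq , q≢x) , ≢-sym p≢q)
      (maxM {X = ∅} (empty (λ ())) (λ ()) none))))
      where
      none : Indep ((S - x - p - y - q) ∖ ∅)
      none (((((Sa , a≢x) , a≢p) , a≢y) , a≢q) , _) _ _ with only Sa
      ... | inj₁ e = a≢x e
      ... | inj₂ (inj₁ e) = a≢y e
      ... | inj₂ (inj₂ (inj₁ e)) = a≢p e
      ... | inj₂ (inj₂ (inj₂ e)) = a≢q e

    -- Here z x is needed to dominate z c, so x p and x y can be used for the 4-cycle.
    three-more : ∀ {c j} → D c → c ~ z → (F : EDS D j)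
      → (∀ i → proj₁ (EDS.edge F i) ≢ c × proj₂ (EDS.edge F i) ≢ c) → EDS Full (3 + j)
    three-more {c} {j} Dc cz (eds edge valid dom priv) avoid = eds edge′ valid′ dom′ priv′
      where
      edge′ : Fin (3 + j) → V × V
      edge′ zero = z , x
      edge′ (suc zero) = x , p
      edge′ (suc (suc zero)) = x , y
      edge′ (suc (suc (suc i))) = edge i
      valid′ : ∀ i → ⊤ × ⊤ × proj₁ (edge′ i) ~ proj₂ (edge′ i)
      valid′ zero = tt , tt , ~-sym x~z
      valid′ (suc zero) = tt , tt , x~p
      valid′ (suc (suc zero)) = tt , tt , x~y
      valid′ (suc (suc (suc i))) = tt , tt , proj₂ (proj₂ (valid i))
      covered : ∀ u → (∃ λ i → proj₁ (edge′ i) ≡ u ⊎ proj₂ (edge′ i) ≡ u) ⊎ u ≡ q ⊎ D u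
      covered u with S? u | u ≟ z
      ... | _ | yes refl = inj₁ (zero , inj₁ refl)
      ... | no u∉S | no u≢z = inj₂ (inj₂ (u∉S , u≢z))
      ... | yes Su | no _ with only Su
      ... | inj₁ refl = inj₁ (zero , inj₂ refl)
      ... | inj₂ (inj₁ refl) = inj₁ (suc (suc zero) , inj₂ refl)
      ... | inj₂ (inj₂ (inj₁ refl)) = inj₁ (suc zero , inj₂ refl)
      ... | inj₂ (inj₂ (inj₂ e)) = inj₂ (inj₁ e)
      dom′ : ∀ {u v} → ⊤ → ⊤ → u ~ v → ∃ λ i → SharesEndpoint u v (edge′ i)
      dom′ {u} {v} _ _ uv with covered u | covered v
      ... | inj₁ (i , inj₁ e) | _ = i , inj₁ e
      ... | inj₁ (i , inj₂ e) | _ = i , inj₂ (inj₂ (inj₁ e))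
      ... | _ | inj₁ (i , inj₁ e) = i , inj₂ (inj₁ e)
      ... | _ | inj₁ (i , inj₂ e) = i , inj₂ (inj₂ (inj₂ e))
      ... | inj₂ (inj₁ refl) | inj₂ (inj₁ refl) = contradiction refl (~⇒≢ uv)
      ... | inj₂ (inj₁ refl) | inj₂ (inj₂ Dv) = ⊥-elim (S≁D Sq Dv uv)
      ... | inj₂ (inj₂ Du) | inj₂ (inj₁ refl) = ⊥-elim (S≁D Sq Du (~-sym uv))
      ... | inj₂ (inj₂ Du) | inj₂ (inj₂ Dv) with dom Du Dv uv
      ...   | i , sh = suc (suc (suc i)) , sh
      z≢ : ∀ {v} → S v → z ≢ v
      z≢ Sv = ≢-sym (S⇒≢z Sv)
      S≢D : ∀ {a b} → S a → D b → a ≢ b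
      S≢D Sa (b∉S , _) refl = b∉S Sa
      p≢x : p ≢ x
      p≢x = ≢-sym (~⇒≢ x~p)
      apart : ∀ {u v} i → u ≡ z ⊎ S u ⊎ u ≡ c → v ≡ z ⊎ S v ⊎ v ≡ c
            → ¬ SharesEndpoint u v (edge i)
      apart i u∈ v∈ = disjoint (away u∈ D₁ (proj₁ (avoid i))) (away v∈ D₁ (proj₁ (avoid i)))
                               (away u∈ D₂ (proj₂ (avoid i))) (away v∈ D₂ (proj₂ (avoid i)))
        where
        D₁ = proj₁ (valid i)
        D₂ = proj₁ (proj₂ (valid i))
        away : ∀ {u a} → u ≡ z ⊎ S u ⊎ u ≡ c → D a → a ≢ c → a ≢ u
        away (inj₁ refl) Da _ = proj₂ Da
        away (inj₂ (inj₁ Su)) Da _ = ≢-sym (S≢D Su Da)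
        away (inj₂ (inj₂ refl)) _ a≢c = a≢c
      priv′ : ∀ i → ∃ λ u → ∃ λ v → ⊤ × ⊤ × u ~ v
            × (∀ j → SharesEndpoint u v (edge′ j) → j ≡ i)
      -- z c is private to z x because the edges in D avoid c. No chosen edge covers q, so p q is
      -- private to x p and y q is private to x y.
      priv′ zero = z , c , tt , tt , ~-sym cz , λ
        { zero _ → refl
        ; (suc zero) e → ⊥-elim (disjoint (S⇒≢z Sx) (S≢D Sx Dc) (S⇒≢z Sp) (S≢D Sp Dc) e)
        ; (suc (suc zero)) e → ⊥-elim (disjoint (S⇒≢z Sx) (S≢D Sx Dc) (S⇒≢z Sy) (S≢D Sy Dc) e)
        ; (suc (suc (suc i))) e → ⊥-elim (apart i (inj₁ refl) (inj₂ (inj₂ refl)) e) }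
      priv′ (suc zero) = p , q , tt , tt , p~q , λ
        { zero e → ⊥-elim (disjoint (z≢ Sp) (z≢ Sq) (≢-sym p≢x) (≢-sym q≢x) e)
        ; (suc zero) _ → refl
        ; (suc (suc zero)) e → ⊥-elim (disjoint (≢-sym p≢x) (≢-sym q≢x) (≢-sym p≢y) (~⇒≢ y~q) e)
        ; (suc (suc (suc i))) e → ⊥-elim (apart i (inj₂ (inj₁ Sp)) (inj₂ (inj₁ Sq)) e) }
      priv′ (suc (suc zero)) = y , q , tt , tt , y~q , λ
        { zero e → ⊥-elim (disjoint (z≢ Sy) (z≢ Sq) (~⇒≢ x~y) (≢-sym q≢x) e)
        ; (suc zero) e → ⊥-elim (disjoint (~⇒≢ x~y) (≢-sym q≢x) p≢y p≢q e)
        ; (suc (suc zero)) _ → refl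
        ; (suc (suc (suc i))) e → ⊥-elim (apart i (inj₂ (inj₁ Sy)) (inj₂ (inj₁ Sq)) e) }
      priv′ (suc (suc (suc i))) with priv i
      ... | u , v , Du , Dv , uv , uniq = u , v , tt , tt , uv , λ
        { zero e → ⊥-elim (disjoint (≢-sym (proj₂ Du)) (≢-sym (proj₂ Dv)) (S≢D Sx Du) (S≢D Sx Dv) e)
        ; (suc zero) e → ⊥-elim (disjoint (S≢D Sx Du) (S≢D Sx Dv) (S≢D Sp Du) (S≢D Sp Dv) e)
        ; (suc (suc zero)) e → ⊥-elim (disjoint (S≢D Sx Du) (S≢D Sx Dv) (S≢D Sy Du) (S≢D Sy Dv) e)
        ; (suc (suc (suc i))) e → cong (λ i → suc (suc (suc i))) (uniq i e) }

    -- If c has no leaf in D, every neighbour of c in D has a second neighbour there, so some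
    -- minimal edge dominating set of D avoids c. It has ν edges, and `three-more` turns it into one
    -- of G with ν + 3, while K = 2 + ν.
    nbr-support : ∀ {c} → D c → c ~ z → ∃ λ l → D l × c ~ l × (∀ a → D a → l ~ a → a ≡ c)
    nbr-support {c} Dc cz
      with any? (λ l → D? l ×-dec (c ~? l) ×-dec all? (λ a → D? a →-dec (l ~? a) →-dec (a ≟ c)))
    ... | yes found = found
    ... | no ¬found = contra (avoiding D? other)
      where
      other : ∀ {d} → D d → c ~ d → ∃ λ a → D a × d ~ a × a ≢ c
      other {d} Dd cd with any? (λ a → D? a ×-dec (d ~? a) ×-dec ¬? (a ≟ c))
      ... | yes found = found
      ... | no ¬a = contradiction (d , Dd , cd , leaf) ¬found
        where
        leaf : ∀ a → D a → d ~ a → a ≡ c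
        leaf a Da da with a ≟ c
        ... | yes e = e
        ... | no a≢c = contradiction (a , Da , da , a≢c) ¬a
      contra : (∃ λ j → Σ (EDS D j) λ F → ∀ i → proj₁ (EDS.edge F i) ≢ c × proj₂ (EDS.edge F i) ≢ c)
             → ∃ λ l → D l × c ~ l × (∀ a → D a → l ~ a → a ≡ c)
      contra (j , F , avoid) with D-uniform F
      ... | refl = ⊥-elim (1+n≢n (trans (uniform (three-more Dc cz F avoid))
                                        (trans (≡-sym K≡μ+ν) (cong (_+ ν) (≡-sym μ≡2)))))

-- Edge sets as lists, and induced subgraphs

lookup-injective : ∀ {A : Set} {xs : List A} {i j} → Unique xs → lookup xs i ≡ lookup xs j → i ≡ j
lookup-injective {xs = _ ∷ _} {zero} {zero} _ _ = refl
lookup-injective {xs = _ ∷ _} {zero} {suc j} (p ∷ _) e = contradiction e (All.lookup p (∈-lookup j))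
lookup-injective {xs = _ ∷ _} {suc i} {zero} (p ∷ _) e =
  contradiction (≡-sym e) (All.lookup p (∈-lookup i))
lookup-injective {xs = _ ∷ _} {suc i} {suc j} (_ ∷ u) e = cong suc (lookup-injective u e)

module Transfer {n : ℕ} (G : Graph n) where

  open EdgeDomination G
  open Cut G using (Full)

  orient : V × V → V × V
  orient (a , b) with <-cmp a b
  ... | tri< _ _ _ = a , b
  ... | tri≈ _ _ _ = a , b
  ... | tri> _ _ _ = b , a

  private
    shares-swap : ∀ {u v a b : V} → SharesEndpoint u v (a , b) → SharesEndpoint u v (b , a)
    shares-swap (inj₁ e) = inj₂ (inj₂ (inj₁ e))
    shares-swap (inj₂ (inj₁ e)) = inj₂ (inj₂ (inj₂ e))
    shares-swap (inj₂ (inj₂ (inj₁ e))) = inj₁ e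
    shares-swap (inj₂ (inj₂ (inj₂ e))) = inj₂ (inj₁ e)

  shares-orient : ∀ {u v} e → SharesEndpoint u v e → SharesEndpoint u v (orient e)
  shares-orient (a , b) sh with <-cmp a b
  ... | tri< _ _ _ = sh
  ... | tri≈ _ _ _ = sh
  ... | tri> _ _ _ = shares-swap sh

  orient-shares : ∀ {u v} e → SharesEndpoint u v (orient e) → SharesEndpoint u v e
  orient-shares (a , b) sh with <-cmp a b
  ... | tri< _ _ _ = sh
  ... | tri≈ _ _ _ = sh
  ... | tri> _ _ _ = shares-swap sh

  orient-valid : ∀ e → proj₁ e ~ proj₂ e
    → proj₁ (orient e) ~ proj₂ (orient e) × proj₁ (orient e) Fin.< proj₂ (orient e)
  orient-valid (a , b) ab with <-cmp a b
  ... | tri< a<b _ _ = ab , a<b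
  ... | tri≈ _ a≡b _ = contradiction a≡b (~⇒≢ ab)
  ... | tri> _ _ b<a = ~-sym ab , b<a

  -- Members are distinct, since equal ones would dominate the same private edge. The list is
  -- minimal, since a dominating sublist must contain a member dominating each private edge, and
  -- there is only one.
  EDS⇒minimal : ∀ {k} → EDS Full k → ∃ λ F → IsMinimalEDS G F × length F ≡ k
  EDS⇒minimal (eds edge valid dom priv) =
    F , (((Allₚ.tabulate⁺ (λ i → orient-valid (edge i) (proj₂ (proj₂ (valid i))))
         , Uniqueₚ.tabulate⁺ injective) , dominates) , minimal) , length-tabulate _
    where
    F : EdgeSet n
    F = tabulate (orient ∘ edge)
    injective : ∀ {i j} → orient (edge i) ≡ orient (edge j) → i ≡ j
    injective {i} {j} e with priv i
    ... | u , v , _ , _ , uv , only with dom tt tt uv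
    ... | l , sh with only l sh
    ... | refl = ≡-sym (only j (orient-shares (edge j)
                   (subst (SharesEndpoint u v) e (shares-orient (edge i) sh))))
    dominates : ∀ u v → Edge G u v → Any (SharesEndpoint u v) F
    dominates u v uv with dom tt tt uv
    ... | i , sh = Anyₚ.tabulate⁺ i (shares-orient (edge i) sh)
    minimal : ∀ F′ → IsEDS G F′ → (∀ {e} → e ∈ F′ → e ∈ F) → ∀ {e} → e ∈ F → e ∈ F′
    minimal F′ (_ , dom′) sub e∈ with ∈-tabulate⁻ e∈
    ... | i , refl with priv i
    ... | u , v , _ , _ , uv , only with find (dom′ u v uv)
    ... | g , g∈ , sh with ∈-tabulate⁻ (sub g∈)
    ... | j , refl with only j (orient-shares (edge j) sh)
    ... | refl = g∈

  WED⇒uniform : WellEdgeDominated G → ∃ λ k → Uniform Full k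
  WED⇒uniform wed with maximal {W = Full} (λ _ → yes tt)
  ... | _ , k , mx with EDS⇒minimal (eds-maximal mx)
  ... | F , min , refl = k , λ E → let (F′ , min′ , eq) = EDS⇒minimal E in
    trans (≡-sym eq) (wed F′ F min′ min)

  record Enumeration (W : VSet) (m : ℕ) : Set where
    field
      at        : Fin m → V
      injective : ∀ {i j} → at i ≡ at j → i ≡ j
      member    : ∀ i → W (at i)
      index-of  : ∀ {v} → W v → ∃ λ i → at i ≡ v

  enumerate : ∀ {W} → Decidable W → ∃ λ m → Enumeration W m
  enumerate {W} W? = length vs , record
    { at = lookup vs
    ; injective = lookup-injective (Uniqueₚ.filter⁺ W? (Uniqueₚ.allFin⁺ n))
    ; member = λ i → proj₂ (∈-filter⁻ W? {xs = allFin n} (∈-lookup i))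
    ; index-of = λ wv → let v∈ = ∈-filter⁺ W? (∈-allFin _) wv in
                        index v∈ , ≡-sym (Anyₚ.lookup-index v∈) }
    where
    vs : List V
    vs = filter W? (allFin n)

  -- Indexing by `punchIn` makes the pullback along the new enumeration definitionally equal to
  -- `deleteV` of the old one, so that uniformity of D yields detachability of z.
  remove : ∀ {W m} (E : Enumeration W (suc m)) (w : Fin (suc m))
         → Enumeration (W - Enumeration.at E w) m
  remove E w = record
    { at = at ∘ punchIn w
    ; injective = punchIn-injective w _ _ ∘ injective
    ; member = λ i → member _ , punchInᵢ≢i w i ∘ injective
    ; index-of = λ (wv , v≢) → let (i , e) = index-of wv
                                   w≢i = λ w≡i → v≢ (trans (≡-sym e) (cong at (≡-sym w≡i)))
                               in punchOut w≢i , trans (cong at (punchIn-punchOut w≢i)) e }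
    where open Enumeration E

  pullback : ∀ {m} → (Fin m → V) → Graph m
  pullback f = record
    { adj = λ i j → adj G (f i) (f j)
    ; sym = λ i j → Graph.sym G (f i) (f j)
    ; irrefl = λ i → irrefl G (f i) }

  module _ {W : VSet} {m : ℕ} (E : Enumeration W m) where

    open Enumeration E

    private
      H : Graph m
      H = pullback at
      module H = Minimisation H

      shares-at : ∀ {u v e} → SharesEndpoint u v e
                → SharesEndpoint (at u) (at v) (at (proj₁ e) , at (proj₂ e))
      shares-at (inj₁ e) = inj₁ (cong at e)
      shares-at (inj₂ (inj₁ e)) = inj₂ (inj₁ (cong at e))
      shares-at (inj₂ (inj₂ (inj₁ e))) = inj₂ (inj₂ (inj₁ (cong at e)))
      shares-at (inj₂ (inj₂ (inj₂ e))) = inj₂ (inj₂ (inj₂ (cong at e)))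

      at-shares : ∀ {u v e} → SharesEndpoint (at u) (at v) (at (proj₁ e) , at (proj₂ e))
                → SharesEndpoint u v e
      at-shares (inj₁ e) = inj₁ (injective e)
      at-shares (inj₂ (inj₁ e)) = inj₂ (inj₁ (injective e))
      at-shares (inj₂ (inj₂ (inj₁ e))) = inj₂ (inj₂ (inj₁ (injective e)))
      at-shares (inj₂ (inj₂ (inj₂ e))) = inj₂ (inj₂ (inj₂ (injective e)))

      -- A member without private edge could be dropped.
      private-edge : ∀ F → IsMinimalEDS H F → ∀ i → H.Private (λ _ → ⊤) (lookup F) i
      private-edge F (((valid , uniq) , dom) , minimal) i
        with H.private? (λ _ → yes tt) (lookup F) i
      ... | yes priv = priv
      ... | no ¬priv = contradiction refl (proj₂ (∈-filter⁻ other? {xs = F}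
              (minimal F′ F′-EDS (λ e∈ → proj₁ (∈-filter⁻ other? e∈)) (∈-lookup i))))
        where
        other? : Decidable (_≢ lookup F i)
        other? e = ¬? (≡-dec _≟_ _≟_ e (lookup F i))
        F′ : EdgeSet m
        F′ = filter other? F
        dom′ : ∀ u v → Edge H u v → Any (SharesEndpoint u v) F′
        dom′ u v uv with any? (λ j → ¬? (j ≟ i) ×-dec H.shares? u v (lookup F j))
        ... | yes (j , j≢i , sh) =
          lose (∈-filter⁺ other? (∈-lookup {xs = F} j) (j≢i ∘ lookup-injective uniq)) sh
        ... | no ¬∃ = ⊥-elim (¬priv (u , v , tt , tt , uv , only))
          where
          only : ∀ j → SharesEndpoint u v (lookup F j) → j ≡ i
          only j sh with j ≟ i
          ... | yes e = e
          ... | no j≢i = contradiction (j , j≢i , sh) ¬∃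
        F′-EDS : IsEDS H F′
        F′-EDS = (Allₚ.filter⁺ other? valid , Uniqueₚ.filter⁺ other? uniq) , dom′

    minimal⇒EDS : ∀ F → IsMinimalEDS H F → EDS W (length F)
    minimal⇒EDS F min@(((valid , _) , dom) , _) = eds
      (λ i → at (proj₁ (lookup F i)) , at (proj₂ (lookup F i)))
      (λ i → member _ , member _ , proj₁ (All.lookup valid (∈-lookup i)))
      dom′
      (λ i → let (u , v , _ , _ , uv , only) = private-edge F min i in
             at u , at v , member u , member v , uv , λ j → only j ∘ at-shares)
      where
      dom′ : ∀ {u v} → W u → W v → u ~ v
           → ∃ λ i → SharesEndpoint u v (at (proj₁ (lookup F i)) , at (proj₂ (lookup F i)))
      dom′ wu wv uv with index-of wu | index-of wv
      ... | i , refl | j , refl with dom i j uv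
      ... | d = index d , shares-at (Anyₚ.lookup-index d)

    uniform⇒WED : ∀ {k} → Uniform W k → WellEdgeDominated (pullback at)
    uniform⇒WED unif F F′ min min′ =
      trans (unif (minimal⇒EDS F min)) (≡-sym (unif (minimal⇒EDS F′ min′)))

-- Counting

private
  true≢false : ∀ {b : Bool} → b ≡ true → b ≢ false
  true≢false refl ()

without : ∀ {m} → (Fin m → Bool) → Fin m → Fin m → Bool
without g w i = g i ∧ not (does (i ≟ w))

without-intro : ∀ {m} (g : Fin m → Bool) {w i} → g i ≡ true → i ≢ w → without g w i ≡ true
without-intro g {w} {i} gi i≢w rewrite gi | dec-false (i ≟ w) i≢w = refl

without-elim : ∀ {m} (g : Fin m → Bool) {w i} → without g w i ≡ true → g i ≡ true × i ≢ w
without-elim g {w} {i} eq with g i | i ≟ w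
without-elim g refl | true | no i≢w = refl , i≢w

card-cong : ∀ {m} {f g : Fin m → Bool} → (∀ i → f i ≡ g i) → card f ≡ card g
card-cong {zero} eq = refl
card-cong {suc m} eq =
  cong₂ (λ b k → (if b then 1 else 0) + k) (eq zero) (card-cong (eq ∘ suc))

card-without : ∀ {m} (g : Fin m → Bool) {w} → g w ≡ true → card g ≡ suc (card (without g w))
card-without g {zero} gw rewrite gw =
  cong suc (card-cong λ i → ≡-sym (∧-identityʳ (g (suc i))))
card-without g {suc w} gw = trans
  (cong₂ (λ b k → (if b then 1 else 0) + k) (≡-sym (∧-identityʳ (g zero))) (card-without (g ∘ suc) gw))
  (+-suc (if without g (suc w) zero then 1 else 0) _)

card-injection : ∀ {m k} (f : Fin m → Bool) (g : Fin k → Bool) (φ : ∀ i → f i ≡ true → Fin k)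
  → (∀ i p → g (φ i p) ≡ true) → (∀ {i j} p q → φ i p ≡ φ j q → i ≡ j) → card f ≤ card g
card-injection {zero} f g φ gφ inj = z≤n
card-injection {suc m} f g φ gφ inj with f zero in f0
... | false = card-injection (f ∘ suc) g (φ ∘ suc) (gφ ∘ suc)
  (λ p q → suc-injective ∘ inj p q)
... | true = subst (suc (card (f ∘ suc)) ≤_) (≡-sym (card-without g (gφ zero f0)))
  (s≤s (card-injection (f ∘ suc) (without g (φ zero f0)) (φ ∘ suc)
    (λ i p → without-intro g (gφ (suc i) p) λ e → case inj f0 p (≡-sym e) of λ ())
    (λ p q → suc-injective ∘ inj p q)))

card-one : ∀ {m} (f : Fin m → Bool) {l} → f l ≡ true → (∀ i → f i ≡ true → i ≡ l) → card f ≡ 1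
card-one f {l} fl only = trans (card-without f fl) (cong suc (≤-antisym
  (card-injection {k = 0} (without f l) (λ ()) (λ i p → ⊥-elim (none p)) (λ i p → ⊥-elim (none p))
    (λ p → ⊥-elim (none p))) z≤n))
  where
  none : ∀ {i} → without f l i ≡ true → ⊥
  none p = let (fi , i≢l) = without-elim f p in i≢l (only _ fi)

-- Assembling G

module Decision {n : ℕ} (G : Graph n) where

  open EdgeDomination G
  open Bipartition G

  reach-mono : ∀ {P Q : VSet} {u v} → P ⊑ Q → Reach P u v → Reach Q u v
  reach-mono f (here p) = here (f p)
  reach-mono f (step p e r) = step (f p) e (reach-mono f r)

  private
    -- A walk may be assumed not to revisit its start, so u is struck from the mask before the
    -- search goes on from its neighbours; the number of vertices left bounds the recursion.
    reach-mask? : ∀ k (g : V → Bool) → card g ≤ k → ∀ u v → Dec (Reach (λ w → g w ≡ true) u v)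
    reach-mask? k g le u v with g u Bool.≟ true
    ... | no ¬gu = no (¬gu ∘ reach-start)
    reach-mask? zero g le u v | yes gu with ≤-trans (≤-reflexive (≡-sym (card-without g gu))) le
    ... | ()
    reach-mask? (suc k) g le u v | yes gu with u ≟ v
    ... | yes refl = yes (here gu)
    ... | no u≢v = map′
      (λ (c , uc , r) → step gu uc (reach-mono (proj₁ ∘ without-elim g) r))
      (λ r → [ (λ e → contradiction (≡-sym e) u≢v)
             , (λ (c , uc , r′) → c , uc , reach-mono (λ (gw , w≢u) → without-intro g gw w≢u) r′) ]′
             (reach-split r))
      (any? λ c → (u ~? c) ×-dec reach-mask? k (without g u)
        (s≤s⁻¹ (subst (_≤ suc k) (card-without g gu) le)) c v)

  reach? : ∀ {P : VSet} → Decidable P → ∀ u v → Dec (Reach P u v)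
  reach? {P} P? u v = map′ (reach-mono to) (reach-mono (λ {w} → dec-true (P? w)))
    (reach-mask? _ (does ∘ P?) ≤-refl u v)
    where
    to : ∀ {w} → does (P? w) ≡ true → P w
    to {w} e with P? w
    ... | yes p = p

module Assembly {n : ℕ} (G : Graph n) where

  open EdgeDomination G
  open Bipartition G
  open Cut G
  open Shape G
  open Transfer G
  open Decision G

  module _ {S : VSet} (S? : Decidable S) {k m} (ES : Enumeration S k) (EW : Enumeration (∁ S) m)
    (H : Graph k) (link : Fin k → Bool) (w : Fin m) where

    private
      module ES = Enumeration ES
      module EW = Enumeration EW

    module _ (adj-S : ∀ a b → adj H a b ≡ adj G (ES.at a) (ES.at b))
      (adj-w : ∀ a → link a ≡ adj G (ES.at a) (EW.at w))
      (adj-W : ∀ a j → j ≢ w → adj G (ES.at a) (EW.at j) ≡ false) where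

      private
        from : Fin k ⊎ Fin m → V
        from = [ ES.at , EW.at ]′

        into : V → Fin k ⊎ Fin m
        into v with S? v
        ... | yes Sv = inj₁ (proj₁ (ES.index-of Sv))
        ... | no v∉S = inj₂ (proj₁ (EW.index-of v∉S))

        from-into : ∀ v → from (into v) ≡ v
        from-into v with S? v
        ... | yes Sv = proj₂ (ES.index-of Sv)
        ... | no v∉S = proj₂ (EW.index-of v∉S)

        from-injective : ∀ s t → from s ≡ from t → s ≡ t
        from-injective (inj₁ a) (inj₁ b) e = cong inj₁ (ES.injective e)
        from-injective (inj₁ a) (inj₂ j) e = contradiction (subst S e (ES.member a)) (EW.member j)
        from-injective (inj₂ i) (inj₁ b) e =
          contradiction (subst S (≡-sym e) (ES.member b)) (EW.member i)
        from-injective (inj₂ i) (inj₂ j) e = cong inj₂ (EW.injective e)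

        cross : ∀ a j → sumAdj H link (pullback EW.at) w (inj₁ a) (inj₂ j) ≡ adj G (ES.at a) (EW.at j)
        cross a j with j ≟ w
        ... | yes refl = trans (∧-identityʳ _) (adj-w a)
        ... | no j≢w = trans (∧-zeroʳ _) (≡-sym (adj-W a j j≢w))

        sum-adj : ∀ s t → sumAdj H link (pullback EW.at) w s t ≡ adj G (from s) (from t)
        sum-adj (inj₁ a) (inj₁ b) = adj-S a b
        sum-adj (inj₁ a) (inj₂ j) = cross a j
        sum-adj (inj₂ i) (inj₁ b) = trans (cross b i) (Graph.sym G _ _)
        sum-adj (inj₂ i) (inj₂ j) = refl

      glue-≅ : G ≅ glue H link (pullback EW.at) w
      glue-≅ = mk↔ₛ′ (join k m ∘ into) (from ∘ splitAt k)
        (λ i → trans (cong (join k m) (from-injective (into (from (splitAt k i))) (splitAt k i) (from-into _))) (join-splitAt k m i))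
        (λ v → trans (cong from (splitAt-join k m (into v))) (from-into v)) ,
        λ u v → trans
          (cong₂ (sumAdj H link (pullback EW.at) w) (splitAt-join k m (into u)) (splitAt-join k m (into v)))
          (trans (sum-adj (into u) (into v)) (cong₂ (adj G) (from-into u) (from-into v)))

  module _ {x y z : V} (s : Setup x y z) (conn-G : Connected G) where

    open Setup s
    open Sides s

    -- After its last visit to z a walk that enters S can never leave it, but this one ends outside
    -- S.
    W-reach : ∀ {v} → W v → Reach W z v
    W-reach {v} v∉S with reach-split (conn-G z v)
    ... | inj₁ refl = here v∉S
    ... | inj₂ (c , zc , r) = step ¬Sz zc (stay r)
      where
      stay : ∀ {a} → Reach (Full - z) a v → Reach W a v
      stay (here _) = here v∉S
      stay (step p e r) =
        step (λ Sa → reach-start (stay r) (cut Sa e (proj₂ (reach-start r)))) e (stay r)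

    W-triangle-free : TriangleFree W
    W-triangle-free {a} {b} {c} a∉S b∉S c∉S ab bc ac with c ≟ z
    ... | no c≢z = tri ab bc ac (λ { refl → c∉S Sx }) (λ { refl → c∉S Sy }) c≢z
    -- `tri` allows z as last vertex; rotating the triangle puts a there instead.
    ... | yes refl = tri bc (~-sym ac) (~-sym ab) (λ { refl → a∉S Sx }) (λ { refl → a∉S Sy }) (~⇒≢ ac)

    one-missable : ∀ {u v} → W u → W v → u ~ v → ExactlyOneMissable W u v
    one-missable u∉S v∉S uv =
      exactly-one-missable ν W? W-triangle-free ¬Sz W-uniform D-uniform (W-reach u∉S) v∉S uv

    private
      -- Missability quantifies over predicates and cannot be searched directly. It is known at z,
      -- and each edge of a walk from z decides it at the next vertex.
      missable? : ∀ {v} → Reach W z v → Dec (Missable W v)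
      missable? {v} r = by-last-step r (yes (root-missable W? W-uniform D-uniform))
        where
        by-last-step : ∀ {u} → Reach W u v → Dec (Missable W u) → Dec (Missable W v)
        by-last-step (here _) d = d
        by-last-step (step p e r) _ with one-missable p (reach-start r) e
        ... | inj₁ (_ , ¬M) = by-last-step r (no ¬M)
        ... | inj₂ (_ , M) = by-last-step r (yes M)

    module _ {m} (E : Enumeration W (suc m)) where

      open Enumeration E

      private
        colour : ∀ i → Dec (Missable W (at i))
        colour i = missable? (W-reach (member i))

      side : Fin (suc m) → Bool
      side i = does (colour i)

      root : Fin (suc m)
      root = proj₁ (index-of ¬Sz)

      at-root : at root ≡ z
      at-root = proj₂ (index-of ¬Sz)

      private
        side-true : ∀ {i} → Missable W (at i) → side i ≡ true
        side-true {i} = dec-true (colour i)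

        side-false : ∀ {i} → ¬ Missable W (at i) → side i ≡ false
        side-false {i} = dec-false (colour i)

        unmissable : ∀ {i} → not (side i) ≡ true → ¬ Missable W (at i)
        unmissable {i} e M with side i | side-true {i} M
        unmissable () M | true | refl

      root-side : side root ≡ true
      root-side = side-true (subst (Missable W) (≡-sym at-root) (root-missable W? W-uniform D-uniform))

      bipartition : IsBipartition (pullback at) side
      bipartition u v uv with one-missable (member u) (member v) uv
      ... | inj₁ (M , ¬M) = λ e → true≢false (trans (≡-sym e) (side-true M)) (side-false ¬M)
      ... | inj₂ (¬M , M) = λ e → true≢false (trans e (side-true M)) (side-false ¬M)

      -- `N₀` is maximal in `W`, so it saturates every unmissable vertex, and the partner of such a
      -- vertex is missable. As `N₀` lies in D, no partner is z. So side A injects into side B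
      -- without z, which makes the inequality strict.
      fewer : card (not ∘ side) < card side
      fewer = subst (card (not ∘ side) <_) (≡-sym (card-without side root-side))
        (s≤s (card-injection (not ∘ side) (without side root) (λ i p → proj₁ (image i p))
          (λ i p → proj₂ (proj₂ (image i p))) injective-image))
        where
        mN₀ = matching N₀-maximal
        f : V → V
        f = proj₁ (partner mN₀)
        N₀-at : ∀ i → not (side i) ≡ true → N₀ (at i)
        N₀-at i p with matched? mN₀ (at i)
        ... | yes q = q
        ... | no ¬q = contradiction (N₀ , ν , MaxM-D⇒MaxM-W N₀-maximal , ¬q) (unmissable p)
        image : ∀ i → not (side i) ≡ true → ∃ λ j → at j ≡ f (at i) × without side root j ≡ true
        image i p with proj₂ (partner mN₀) (at i) (N₀-at i p)
        ... | q , e , _ with inside N₀-maximal q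
        ... | f∉S , f≢z with index-of f∉S
        ... | j , ej = j , ej , without-intro side (side-true (M (one-missable (member i) f∉S e)))
                                  (λ { refl → f≢z (trans (≡-sym ej) at-root) })
          where
          M : ExactlyOneMissable W (at i) (f (at i)) → Missable W (at j)
          M (inj₁ (M , _)) = contradiction M (unmissable p)
          M (inj₂ (_ , M)) = subst (Missable W) (≡-sym ej) M
        injective-image : ∀ {i j} p q → proj₁ (image i p) ≡ proj₁ (image j q) → i ≡ j
        injective-image {i} {j} p q e = injective (trans (≡-sym (back i p)) (trans (cong f
          (trans (≡-sym (proj₁ (proj₂ (image i p)))) (trans (cong at e) (proj₁ (proj₂ (image j q))))))
          (back j q)))
          where
          back : ∀ i → not (side i) ≡ true → f (f (at i)) ≡ at i
          back i p = proj₂ (proj₂ (proj₂ (partner mN₀) (at i) (N₀-at i p)))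

      setup : DetachableSetup (pullback at) side root
      setup = bipartition , fewer , uniform⇒WED E W-uniform , root-side ,
        uniform⇒WED (remove E root) (subst (λ v → Uniform (W - v) ν) (≡-sym at-root) D-uniform)

      nbr-supports : (∀ {c} → D c → c ~ z → ∃ λ l → D l × c ~ l × (∀ a → D a → l ~ a → a ≡ c))
        → ∀ i → Edge (pullback at) root (punchIn root i) → Support (deleteV (pullback at) root) i
      nbr-supports support i ri with support D-i (~-sym (subst (_~ at (punchIn root i)) at-root ri))
        where
        D-i : D (at (punchIn root i))
        D-i = member _ , λ e → punchInᵢ≢i root i (injective (trans e (≡-sym at-root)))
      ... | l , (l∉S , l≢z) , il , leaf
        with Enumeration.index-of (remove E root) (l∉S , λ e → l≢z (trans e at-root))
      ... | j , refl = j , il , card-one (adj (deleteV (pullback at) root) j) (~-sym il) λ a ja →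
        Enumeration.injective (remove E root)
          (leaf _ (member _ , λ e → punchInᵢ≢i root a (injective (trans e (≡-sym at-root)))) ja)

    far : ∀ {m} (E : Enumeration W (suc m)) {v} j → S v → j ≢ root E
        → adj G v (Enumeration.at E j) ≡ false
    far E {v} j Sv j≢root = ¬-not (S≁D Sv (member j , λ e → j≢root (injective (trans e (≡-sym (at-root E))))))
      where open Enumeration E

    triangle-case : (∀ {v} → S v → v ≡ x ⊎ v ≡ y) → In𝒯 G
    triangle-case only with enumerate W?
    ... | zero , E with Enumeration.index-of E ¬Sz
    ...   | () , _
    triangle-case only | suc m , E = m , pullback (Enumeration.at E) , side E , root E , setup E ,
      glue-≅ S? ES E K2 (λ _ → true) (root E) adj-S adj-w (λ a j → far E j (Sσ a))
      where
      σ : Fin 2 → V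
      σ zero = x
      σ (suc zero) = y
      Sσ : ∀ i → S (σ i)
      Sσ zero = Sx
      Sσ (suc zero) = Sy
      σ-injective : ∀ {i j} → σ i ≡ σ j → i ≡ j
      σ-injective {zero} {zero} _ = refl
      σ-injective {zero} {suc zero} e = contradiction e (~⇒≢ x~y)
      σ-injective {suc zero} {zero} e = contradiction (≡-sym e) (~⇒≢ x~y)
      σ-injective {suc zero} {suc zero} _ = refl
      ES : Enumeration S 2
      ES = record { at = σ ; injective = σ-injective ; member = Sσ
                  ; index-of = λ Sv → [ (λ e → zero , ≡-sym e) , (λ e → suc zero , ≡-sym e) ]′ (only Sv) }
      adj-S : ∀ a b → adj K2 a b ≡ adj G (σ a) (σ b)
      adj-S zero zero = ≡-sym (irrefl G x)
      adj-S zero (suc zero) = ≡-sym x~y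
      adj-S (suc zero) zero = ≡-sym (~-sym x~y)
      adj-S (suc zero) (suc zero) = ≡-sym (irrefl G y)
      adj-w : ∀ a → true ≡ adj G (σ a) (Enumeration.at E (root E))
      adj-w zero = ≡-sym (subst (x ~_) (≡-sym (at-root E)) x~z)
      adj-w (suc zero) = ≡-sym (subst (y ~_) (≡-sym (at-root E)) y~z)

    house-case : ∀ {p q} → House s p q → Inℱ G
    house-case {p} {q} h with enumerate W?
    ... | zero , E with Enumeration.index-of E ¬Sz
    ...   | () , _
    house-case {p} {q} h | suc m , E = m , pullback (Enumeration.at E) , side E , root E ,
      (setup E , nbr-supports E (HouseProperties.nbr-support s h)) ,
      glue-≅ S? ES E C4 houseLink (root E) adj-S adj-w (λ a j → far E j (Sσ a))
      where
      open House h
      q≁x : ¬ q ~ x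
      q≁x qx = tri x~y y~q (~-sym qx) q≢x (≢-sym (~⇒≢ y~q)) (S⇒≢z Sq)
      p≁y : ¬ p ~ y
      p≁y py = tri (~-sym x~y) x~p (~-sym py) (≢-sym (~⇒≢ x~p)) p≢y (S⇒≢z Sp)
      p≁z : ¬ p ~ z
      p≁z pz = tri x~z (~-sym pz) x~p (≢-sym (~⇒≢ x~p)) p≢y (S⇒≢z Sp)
      q≁z : ¬ q ~ z
      q≁z qz = tri y~z (~-sym qz) y~q q≢x (≢-sym (~⇒≢ y~q)) (S⇒≢z Sq)
      pattern 0F = zero
      pattern 1F = suc zero
      pattern 2F = suc (suc zero)
      pattern 3F = suc (suc (suc zero))
      -- q, p, x, y play the roles of p₁, p₂, p₃, p₄ of the house, so that `houseLink` joins exactly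
      -- x and y to z.
      σ : Fin 4 → V
      σ 0F = q
      σ 1F = p
      σ 2F = x
      σ 3F = y
      Sσ : ∀ i → S (σ i)
      Sσ 0F = Sq
      Sσ 1F = Sp
      Sσ 2F = Sx
      Sσ 3F = Sy
      σ-injective : ∀ {i j} → σ i ≡ σ j → i ≡ j
      σ-injective {0F} {0F} _ = refl
      σ-injective {0F} {1F} e = contradiction (≡-sym e) p≢q
      σ-injective {0F} {2F} e = contradiction e q≢x
      σ-injective {0F} {3F} e = contradiction (≡-sym e) (~⇒≢ y~q)
      σ-injective {1F} {0F} e = contradiction e p≢q
      σ-injective {1F} {1F} _ = refl
      σ-injective {1F} {2F} e = contradiction (≡-sym e) (~⇒≢ x~p)
      σ-injective {1F} {3F} e = contradiction e p≢y
      σ-injective {2F} {0F} e = contradiction (≡-sym e) q≢x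
      σ-injective {2F} {1F} e = contradiction e (~⇒≢ x~p)
      σ-injective {2F} {2F} _ = refl
      σ-injective {2F} {3F} e = contradiction e (~⇒≢ x~y)
      σ-injective {3F} {0F} e = contradiction e (~⇒≢ y~q)
      σ-injective {3F} {1F} e = contradiction (≡-sym e) p≢y
      σ-injective {3F} {2F} e = contradiction (≡-sym e) (~⇒≢ x~y)
      σ-injective {3F} {3F} _ = refl
      position : ∀ {v} → v ≡ x ⊎ v ≡ y ⊎ v ≡ p ⊎ v ≡ q → ∃ λ i → σ i ≡ v
      position (inj₁ e) = 2F , ≡-sym e
      position (inj₂ (inj₁ e)) = 3F , ≡-sym e
      position (inj₂ (inj₂ (inj₁ e))) = 1F , ≡-sym e
      position (inj₂ (inj₂ (inj₂ e))) = 0F , ≡-sym e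
      ES : Enumeration S 4
      ES = record { at = σ ; injective = σ-injective ; member = Sσ ; index-of = λ Sv → position (only Sv) }
      adj-S : ∀ a b → adj C4 a b ≡ adj G (σ a) (σ b)
      adj-S 0F 0F = ≡-sym (irrefl G q)
      adj-S 0F 1F = ≡-sym (~-sym p~q)
      adj-S 0F 2F = ≡-sym (¬-not q≁x)
      adj-S 0F 3F = ≡-sym (~-sym y~q)
      adj-S 1F 0F = ≡-sym p~q
      adj-S 1F 1F = ≡-sym (irrefl G p)
      adj-S 1F 2F = ≡-sym (~-sym x~p)
      adj-S 1F 3F = ≡-sym (¬-not p≁y)
      adj-S 2F 0F = ≡-sym (¬-not (q≁x ∘ ~-sym))
      adj-S 2F 1F = ≡-sym x~p
      adj-S 2F 2F = ≡-sym (irrefl G x)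
      adj-S 2F 3F = ≡-sym x~y
      adj-S 3F 0F = ≡-sym y~q
      adj-S 3F 1F = ≡-sym (¬-not (p≁y ∘ ~-sym))
      adj-S 3F 2F = ≡-sym (~-sym x~y)
      adj-S 3F 3F = ≡-sym (irrefl G y)
      adj-w : ∀ a → houseLink a ≡ adj G (σ a) (Enumeration.at E (root E))
      adj-w a = trans (link a) (cong (adj G (σ a)) (≡-sym (at-root E)))
        where
        link : ∀ a → houseLink a ≡ adj G (σ a) z
        link 0F = ≡-sym (¬-not q≁z)
        link 1F = ≡-sym (¬-not p≁z)
        link 2F = ≡-sym x~z
        link 3F = ≡-sym y~z

  make-setup : Connected G → WellEdgeDominated G → ∀ {x y z} → UniqueTriangle G x y z
    → HasFarComponent G x y z → Setup x y z
  make-setup conn wed {x} {y} {z} ((xy , yz , xz) , unique) (u , _ , out-u , _ , _ , far) =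
    attached (conn u z) (here out-u)
    where
    Outside : V → Set
    Outside a = ¬ In3 x y z a
    Far : V → Set
    Far = Reach Outside u
    x≁far : ∀ {t} → Far t → ¬ t ~ x
    x≁far r tx = true≢false tx (proj₁ (far _ r))
    y≁far : ∀ {t} → Far t → ¬ t ~ y
    y≁far r ty = true≢false ty (proj₂ (far _ r))
    S : V → Set
    S = Reach (_≢ z) x
    -- Traced backwards from the far component, a walk avoiding z meets neither x nor y, which have
    -- no neighbour there, so it stays in that component. A walk starting at x therefore never
    -- reaches it.
    far-back : ∀ {a t} → Reach (_≢ z) a t → Far t → Far a
    far-back (here _) Ft = Ft
    far-back {a} (step a≢z e r) Ft = reach-snoc Fw (~-sym e)
      λ { (inj₁ refl) → x≁far Fw (~-sym e) ; (inj₂ (inj₁ refl)) → y≁far Fw (~-sym e)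
        ; (inj₂ (inj₂ p)) → a≢z p }
      where Fw = far-back r Ft
    S-not-far : ∀ {t} → Far t → ¬ S t
    S-not-far Ft r = reach-end (far-back r Ft) (inj₁ refl)
    with-attachment : ∀ {c} → Far c → c ~ z → Setup x y z
    with-attachment {c} Fc cz = record
      { S = S ; S? = reach? (λ w → ¬? (w ≟ z)) x
      ; Sx = here (~⇒≢ xz) ; Sy = step (~⇒≢ xz) xy (here (~⇒≢ yz))
      ; ¬Sz = λ r → reach-end r refl ; cut = reach-snoc ; x~y = xy ; x~z = xz ; y~z = yz
      ; tri = λ {a} {b} {c} ab bc ac c≢x c≢y c≢z →
          [ c≢x , [ c≢y , c≢z ]′ ]′ (proj₂ (proj₂ (unique a b c (ab , bc , ac))))
      ; conn = id ; c₀ = c ; c₀∉S = S-not-far Fc ; c₀≢z = λ { refl → reach-end Fc (inj₂ (inj₂ refl)) }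
      ; c₀~z = cz ; K = proj₁ (WED⇒uniform wed) ; uniform = proj₂ (WED⇒uniform wed) }
    -- A walk from the far component to z cannot pass through x or y; the vertex before its first
    -- visit to z serves as c₀.
    attached : ∀ {t} → Reach (λ _ → ⊤) t z → Far t → Setup x y z
    attached (here _) Ft = contradiction (inj₂ (inj₂ refl)) (reach-end Ft)
    attached (step {w = w} _ e r) Ft with w ≟ z
    ... | yes refl = with-attachment Ft e
    ... | no w≢z = attached r (reach-snoc Ft e
      λ { (inj₁ refl) → x≁far Ft e ; (inj₂ (inj₁ refl)) → y≁far Ft e ; (inj₂ (inj₂ p)) → w≢z p })

theorem7 : ∀ (n : ℕ) (G : Graph n) → Connected G → WellEdgeDominated G
    → (x y z : Fin n) → UniqueTriangle G x y z → HasFarComponent G x y z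
    → Inℱ G ⊎ In𝒯 G
theorem7 n G conn wed x y z triangle far with Assembly.make-setup G conn wed triangle far
... | s with Shape.shape G s
... | inj₁ only = inj₂ (Assembly.triangle-case G s conn only)
... | inj₂ (_ , _ , h) = inj₁ (Assembly.house-case G s conn h)
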